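{- Let $n\ge 2$ be an integer and let $x,y$ be complex numbers such that no denominator below vanishes, i.e. $x\notin\{ -1,\dots,-n\}$, $x-y\notin\{ -1,\dots,-n\}$ and $y\notin\{ -n,-n+1,\dots,n-1\}$. Then $$\sum_{k=0}^n(-1)^k\binom{n}{k}\frac{\binom{y+k}{k}}{\binom{y-n+k}{k}}\frac{(y-1)y}{(y+k-1)(y+k)}H_{k}^{\langle4\rangle}(x)$$ $$=\frac{(-1)^n}{6n(n-1)(1+x-y)}\,\frac{\binom{x-y+n}{n}}{\binom{x+n}{n}\binom{y}{n}}\bigg\{(1+x-y+ny)E_n(x,y)+\frac{3ny}{1+x-y}F_n(x,y)+G_n(x,y)\bigg\},$$ where $$E_n(x,y)=\big[H_{n}(x)-H_{n}(x-y)\big]^3+2\big[H_{n}^{\langle3\rangle}(x)-H_{n}^{\langle3\rangle}(x-y)\big]+3\big[H_{n}(x)-H_{n}(x-y)\big]\big[H_{n}^{\langle2\rangle}(x)-H_{n}^{\langle2\rangle}(x-y)\big],$$ $$F_n(x,y)=\big[H_{n}(x)-H_{n}(x-y)\big]^2+\big[H_{n}^{\langle2\rangle}(x)-H_{n}^{\langle2\rangle}(x-y)\big],$$ $$G_n(x,y)=\frac{6ny}{(1+x-y)^2}\big[H_{n}(x)-H_{n}(x-y)\big]+\frac{6ny}{(1+x-y)^3}.$$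
   Context: For a complex number $u$ and an integer $k\ge 0$, $\binom{u}{k}=\frac{u(u-1)\cdots(u-k+1)}{k!}$ (equal to $1$ for $k=0$). For a complex number $u$ and a positive integer $\ell$, the generalized harmonic numbers of $\ell$-order are $H_0^{\langle\ell\rangle}(u)=0$ and $H_n^{\langle\ell\rangle}(u)=\sum_{k=1}^n\frac{1}{(u+k)^\ell}$ for $n\ge1$; $H_n(u)=H_n^{\langle1\rangle}(u)$. -}

module Defs where

open import Algebra.Apartness.Bundles using (HeytingCommutativeRing; HeytingField)
import Algebra.Apartness.Properties.HeytingCommutativeRing as HeytingProperties
open import Algebra.Bundles using (CommutativeRing)
import Algebra.Properties.Group as GroupProperties
import Algebra.Properties.Monoid.Mult as Mult
import Algebra.Properties.Semiring.Exp as Exp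
import Algebra.Properties.Semiring.Sum as Sums
open import Data.Fin.Base using (Fin; toℕ)
import Data.Fin.Properties as Fin
open import Data.Integer.Base as ℤ using (ℤ; +_; -[1+_]; _⊖_; -1ℤ; 1ℤ)
import Data.Integer.Properties as ℤ
open import Data.Maybe.Base using (Maybe)
open import Data.Nat.Base as ℕ using (ℕ; zero; suc; s≤s; z≤n; _!)
import Data.Nat.Properties as ℕ
open import Data.Product.Base using (∃-syntax; _×_; _,_; proj₁)
open import Data.Rational.Base as ℚ using (ℚ; 0ℚ; 1ℚ; ½; ∣_∣)
import Data.Rational.Properties as ℚ
open import Data.Sum.Base as Sum using (_⊎_; inj₁; inj₂; [_,_]′)
open import Function.Base using (_∘_)
open import Level using (0ℓ)
import Relation.Binary.Reasoning.Setoid as SetoidReasoning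
open import Relation.Binary.PropositionalEquality
  using (_≡_; _≢_; refl; sym; trans; cong; cong₂; subst; subst₂)
open import Relation.Nullary using (¬_; yes; no; contradiction)
open import Relation.Nullary.Decidable.Core using (dec⇒maybe)
import Tactic.RingSolver as Solver
import Tactic.RingSolver.Core.AlmostCommutativeRing as Solver

module RationalEstimates where

  open import Data.Rational.Base
    using (_+_; _*_; _-_; -_; _<_; _≤_; 1/_; positive; nonNegative; ≢-nonZero)

  0≟_ : ∀ p → Maybe (0ℚ ≡ p)
  0≟ p = dec⇒maybe (0ℚ ℚ.≟ p)

  ring : Solver.AlmostCommutativeRing 0ℓ 0ℓ
  ring = Solver.fromCommutativeRing ℚ.+-*-commutativeRing 0≟_

  0<½* : ∀ {ε} → 0ℚ < ε → 0ℚ < ½ * ε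
  0<½* {ε} 0<ε = subst (_< ½ * ε) (ℚ.*-zeroʳ ½) (ℚ.*-monoʳ-<-pos ½ 0<ε)

  ½+½ : ∀ ε → ½ * ε + ½ * ε ≡ ε
  ½+½ ε = trans (sym (ℚ.*-distribʳ-+ ε ½ ½)) (ℚ.*-identityˡ ε)

  0<1 : 0ℚ < 1ℚ
  0<1 = ℚ.positive⁻¹ 1ℚ

  *-0< : ∀ {c d} → 0ℚ < c → 0ℚ < d → 0ℚ < c * d
  *-0< {c} {d} 0<c 0<d =
    subst (_< c * d) (ℚ.*-zeroʳ c) (ℚ.*-monoʳ-<-pos c {{positive 0<c}} 0<d)

  +-small : ∀ {a b ε} → ∣ a ∣ < ½ * ε → ∣ b ∣ < ½ * ε → ∣ a + b ∣ < ε
  +-small {a} {b} {ε} a< b< = ℚ.≤-<-trans (ℚ.∣p+q∣≤∣p∣+∣q∣ a b)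
    (subst (∣ a ∣ + ∣ b ∣ <_) (½+½ ε) (ℚ.+-mono-< a< b<))

  *-small : ∀ {a b c d} → 0ℚ < c → ∣ a ∣ ≤ c → ∣ b ∣ < d → ∣ a * b ∣ < c * d
  *-small {a} {b} {c} {d} 0<c a≤ b< = subst (_< c * d) (sym (ℚ.∣p*q∣≡∣p∣*∣q∣ a b))
    (ℚ.≤-<-trans (ℚ.*-monoʳ-≤-nonNeg ∣ b ∣ {{ℚ.∣-∣-nonNeg b}} a≤)
                 (ℚ.*-monoʳ-<-pos c {{positive 0<c}} b<))

  *-bound : ∀ {a b c d} → 0ℚ < c → ∣ a ∣ ≤ c → ∣ b ∣ ≤ d → ∣ a * b ∣ ≤ c * d
  *-bound {a} {b} {c} {d} 0<c a≤ b≤ = subst (_≤ c * d) (sym (ℚ.∣p*q∣≡∣p∣*∣q∣ a b))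
    (ℚ.≤-trans (ℚ.*-monoʳ-≤-nonNeg ∣ b ∣ {{ℚ.∣-∣-nonNeg b}} a≤)
               (ℚ.*-monoˡ-≤-nonNeg c {{nonNegative (ℚ.<⇒≤ 0<c)}} b≤))

  *-large : ∀ {a b c d} → 0ℚ < c → c ≤ ∣ a ∣ → d ≤ ∣ b ∣ → c * d ≤ ∣ a * b ∣
  *-large {a} {b} {c} {d} 0<c ≤a ≤b = subst (c * d ≤_) (sym (ℚ.∣p*q∣≡∣p∣*∣q∣ a b))
    (ℚ.≤-trans (ℚ.*-monoˡ-≤-nonNeg c {{nonNegative (ℚ.<⇒≤ 0<c)}} ≤b)
               (ℚ.*-monoʳ-≤-nonNeg ∣ b ∣ {{ℚ.∣-∣-nonNeg b}} ≤a))

  *-cancel-≤ : ∀ {c p q} → 0ℚ < c → c * p ≤ c * q → p ≤ q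
  *-cancel-≤ {c} 0<c = ℚ.*-cancelˡ-≤-pos c {{positive 0<c}}

  divide : ∀ {c} ε → 0ℚ < c → 0ℚ < ε → ∃[ δ ] 0ℚ < δ × c * δ ≡ ε
  divide {c} ε 0<c 0<ε = c⁻¹ * ε , *-0< 0<c⁻¹ 0<ε ,
    trans (sym (ℚ.*-assoc c c⁻¹ ε)) (trans (cong (_* ε) (ℚ.*-inverseʳ c)) (ℚ.*-identityˡ ε))
    where
    instance
      _ = positive 0<c
      _ = ℚ.pos⇒nonZero c
    c⁻¹ = 1/ c
    0<c⁻¹ : 0ℚ < c⁻¹
    0<c⁻¹ = ℚ.positive⁻¹ c⁻¹ {{ℚ.1/pos⇒pos c}}

  ∣-∣-comm : ∀ a b → ∣ a - b ∣ ≡ ∣ b - a ∣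
  ∣-∣-comm a b = trans (sym (ℚ.∣-p∣≡∣p∣ (a - b))) (cong ∣_∣ (swap a b))
    where
    swap : ∀ a b → - (a - b) ≡ b - a
    swap = Solver.solve-∀ ring

  b+[a-b]≡a : ∀ a b → b + (a - b) ≡ a
  b+[a-b]≡a = Solver.solve-∀ ring

  0≤square : ∀ q → 0ℚ ≤ q * q
  0≤square q = subst (0ℚ ≤_) ∣q∣²≡q² (subst (0ℚ ≤_) (ℚ.∣p*q∣≡∣p∣*∣q∣ q q) (ℚ.0≤∣p∣ (q * q)))
    where
    -q*-q : ∀ q → - q * - q ≡ q * q
    -q*-q = Solver.solve-∀ ring
    ∣q∣²≡q² : ∣ q ∣ * ∣ q ∣ ≡ q * q
    ∣q∣²≡q² with ℚ.∣p∣≡p∨∣p∣≡-p q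
    ... | inj₁ e = cong₂ _*_ e e
    ... | inj₂ e = trans (cong₂ _*_ e e) (-q*-q q)

  square-+ : ∀ {ε} p q → ε ≤ ∣ p * p ∣ → ε ≤ ∣ p * p + q * q ∣
  square-+ {ε} p q ε≤ = subst (ε ≤_)
    (sym (ℚ.0≤p⇒∣p∣≡p (ℚ.+-mono-≤ (0≤square p) (0≤square q))))
    (ℚ.≤-trans (subst (ε ≤_) (ℚ.0≤p⇒∣p∣≡p (0≤square p)) ε≤)
      (subst (_≤ p * p + q * q) (ℚ.+-identityʳ (p * p)) (ℚ.+-monoʳ-≤ (p * p) (0≤square q))))

  -- The reciprocal, extended by 0 at 0.
  recip : ℚ → ℚ
  recip q with q ℚ.≟ 0ℚ
  ... | yes _ = 0ℚ
  ... | no q≢0 = (1/ q) {{≢-nonZero q≢0}}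

  recip-inverse : ∀ {q} → q ≢ 0ℚ → q * recip q ≡ 1ℚ
  recip-inverse {q} q≢0 with q ℚ.≟ 0ℚ
  ... | yes q≡0 = contradiction q≡0 q≢0
  ... | no q≢0′ = ℚ.*-inverseʳ q {{≢-nonZero q≢0′}}

  ≢0 : ∀ {ε q} → 0ℚ < ε → ε ≤ ∣ q ∣ → q ≢ 0ℚ
  ≢0 0<ε ε≤∣0∣ refl = ℚ.<-irrefl refl (ℚ.<-≤-trans 0<ε ε≤∣0∣)

module Sequences where

  open import Data.Rational.Base using (_+_; _*_; _-_; -_; _<_; _≤_)
  open RationalEstimates

  Eventually : (ℕ → Set) → Set
  Eventually P = ∃[ N ] (∀ n → N ℕ.≤ n → P n)

  Cauchy : (ℕ → ℚ) → Set
  Cauchy f = ∀ {ε} → 0ℚ < ε → ∃[ N ] (∀ m n → N ℕ.≤ m → N ℕ.≤ n → ∣ f m - f n ∣ < ε)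

  Null : (ℕ → ℚ) → Set
  Null f = ∀ {ε} → 0ℚ < ε → Eventually (λ n → ∣ f n ∣ < ε)

  BoundedAway : (ℕ → ℚ) → Set
  BoundedAway f = ∃[ ε ] 0ℚ < ε × Eventually (λ n → ε ≤ ∣ f n ∣)

  Bounded : (ℕ → ℚ) → Set
  Bounded f = ∃[ c ] 0ℚ < c × Eventually (λ n → ∣ f n ∣ ≤ c)

  private variable
    f g : ℕ → ℚ
    P Q R : ℕ → Set

  abstract

    both : (∀ n → P n → Q n → R n) → Eventually P → Eventually Q → Eventually R
    both h (N , p) (M , q) = N ℕ.⊔ M , λ n N⊔M≤n →
      h n (p n (ℕ.m⊔n≤o⇒m≤o N M N⊔M≤n)) (q n (ℕ.m⊔n≤o⇒n≤o N M N⊔M≤n))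

    weaken : (∀ n → P n → Q n) → Eventually P → Eventually Q
    weaken h (N , p) = N , λ n N≤n → h n (p n N≤n)

    Null-resp : (∀ n → f n ≡ g n) → Null f → Null g
    Null-resp f≡g null 0<ε = weaken (λ n → subst (λ z → ∣ z ∣ < _) (f≡g n)) (null 0<ε)

    Null-0 : (∀ n → f n ≡ 0ℚ) → Null f
    Null-0 f≡0 {ε} 0<ε = 0 , λ n _ → subst (λ z → ∣ z ∣ < ε) (sym (f≡0 n)) 0<ε

    Null-+ : Null f → Null g → Null (λ n → f n + g n)
    Null-+ F G 0<ε = both (λ _ → +-small) (F (0<½* 0<ε)) (G (0<½* 0<ε))

    Null-neg : Null f → Null (λ n → - f n)
    Null-neg {f} F 0<ε = weaken (λ n → subst (_< _) (sym (ℚ.∣-p∣≡∣p∣ (f n)))) (F 0<ε)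

    Null-* : Bounded f → Null g → Null (λ n → f n * g n)
    Null-* (c , 0<c , F) G {ε} 0<ε with δ , 0<δ , refl ← divide ε 0<c 0<ε =
      both (λ _ → *-small 0<c) F (G 0<δ)

    Cauchy⇒Bounded : Cauchy f → Bounded f
    Cauchy⇒Bounded {f} F with N , near ← F 0<1 =
      ∣ f N ∣ + 1ℚ ,
      ℚ.+-mono-≤-< (ℚ.0≤∣p∣ (f N)) 0<1 ,
      N , λ n N≤n → subst (λ z → ∣ z ∣ ≤ ∣ f N ∣ + 1ℚ) (b+[a-b]≡a (f n) (f N))
        (ℚ.≤-trans (ℚ.∣p+q∣≤∣p∣+∣q∣ (f N) (f n - f N))
                   (ℚ.+-monoʳ-≤ ∣ f N ∣ (ℚ.<⇒≤ (near n N N≤n ℕ.≤-refl))))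

    Cauchy-const : ∀ q → Cauchy (λ _ → q)
    Cauchy-const q {ε} 0<ε = 0 , λ _ _ _ _ → subst (λ z → ∣ z ∣ < ε) (sym (ℚ.+-inverseʳ q)) 0<ε

    Cauchy-+ : Cauchy f → Cauchy g → Cauchy (λ n → f n + g n)
    Cauchy-+ {f} {g} F G 0<ε
      with N , p ← F (0<½* 0<ε) | M , q ← G (0<½* 0<ε) = N ℕ.⊔ M , λ m n ≤m ≤n →
      subst (λ z → ∣ z ∣ < _) (eq (f m) (f n) (g m) (g n))
        (+-small (p m n (ℕ.m⊔n≤o⇒m≤o N M ≤m) (ℕ.m⊔n≤o⇒m≤o N M ≤n))
                 (q m n (ℕ.m⊔n≤o⇒n≤o N M ≤m) (ℕ.m⊔n≤o⇒n≤o N M ≤n)))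
      where
      eq : ∀ a b c d → (a - b) + (c - d) ≡ (a + c) - (b + d)
      eq = Solver.solve-∀ ring

    Cauchy-neg : Cauchy f → Cauchy (λ n → - f n)
    Cauchy-neg {f} F 0<ε with N , p ← F 0<ε = N , λ m n ≤m ≤n →
      subst (_< _) (trans (∣-∣-comm (f m) (f n)) (cong ∣_∣ (eq (f m) (f n)))) (p m n ≤m ≤n)
      where
      eq : ∀ a b → b - a ≡ - a - (- b)
      eq = Solver.solve-∀ ring

    Cauchy-* : Cauchy f → Cauchy g → Cauchy (λ n → f n * g n)
    Cauchy-* {f} {g} F G {ε} 0<ε = combine (Cauchy⇒Bounded {f} F) (Cauchy⇒Bounded {g} G)
      where
      eq : ∀ a b c d → a * (c - d) + d * (a - b) ≡ a * c - b * d
      eq = Solver.solve-∀ ring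
      estimate : ∀ {c d δ η} → 0ℚ < c → 0ℚ < d → c * δ ≡ ½ * ε → d * η ≡ ½ * ε → ∀ m n →
        ∣ f m ∣ ≤ c → ∣ g n ∣ ≤ d → ∣ g m - g n ∣ < δ → ∣ f m - f n ∣ < η →
        ∣ f m * g m - f n * g n ∣ < ε
      estimate 0<c 0<d cδ dη m n f≤c g≤d g< f< =
        subst (λ z → ∣ z ∣ < ε) (eq (f m) (f n) (g m) (g n))
          (+-small (subst (∣ f m * (g m - g n) ∣ <_) cδ (*-small 0<c f≤c g<))
                   (subst (∣ g n * (f m - f n) ∣ <_) dη (*-small 0<d g≤d f<)))
      combine : Bounded f → Bounded g →
        ∃[ N ] (∀ m n → N ℕ.≤ m → N ℕ.≤ n → ∣ f m * g m - f n * g n ∣ < ε)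
      combine (c , 0<c , N₁ , f≤c) (d , 0<d , N₂ , g≤d) =
        choose (divide (½ * ε) 0<c (0<½* 0<ε)) (divide (½ * ε) 0<d (0<½* 0<ε))
        where
        choose : ∃[ δ ] 0ℚ < δ × c * δ ≡ ½ * ε → ∃[ η ] 0ℚ < η × d * η ≡ ½ * ε →
          ∃[ N ] (∀ m n → N ℕ.≤ m → N ℕ.≤ n → ∣ f m * g m - f n * g n ∣ < ε)
        choose (δ , 0<δ , cδ) (η , 0<η , dη) with M₁ , p ← G 0<δ | M₂ , q ← F 0<η =
          (N₁ ℕ.⊔ N₂) ℕ.⊔ (M₁ ℕ.⊔ M₂) , λ m n ≤m ≤n →
            estimate 0<c 0<d cδ dη m n (f≤c m (≤N₁ ≤m)) (g≤d n (≤N₂ ≤n))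
              (p m n (≤M₁ ≤m) (≤M₁ ≤n)) (q m n (≤M₂ ≤m) (≤M₂ ≤n))
          where
          ≤N₁ : ∀ {n} → (N₁ ℕ.⊔ N₂) ℕ.⊔ (M₁ ℕ.⊔ M₂) ℕ.≤ n → N₁ ℕ.≤ n
          ≤N₁ = ℕ.m⊔n≤o⇒m≤o N₁ N₂ ∘ ℕ.m⊔n≤o⇒m≤o (N₁ ℕ.⊔ N₂) (M₁ ℕ.⊔ M₂)
          ≤N₂ : ∀ {n} → (N₁ ℕ.⊔ N₂) ℕ.⊔ (M₁ ℕ.⊔ M₂) ℕ.≤ n → N₂ ℕ.≤ n
          ≤N₂ = ℕ.m⊔n≤o⇒n≤o N₁ N₂ ∘ ℕ.m⊔n≤o⇒m≤o (N₁ ℕ.⊔ N₂) (M₁ ℕ.⊔ M₂)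
          ≤M₁ : ∀ {n} → (N₁ ℕ.⊔ N₂) ℕ.⊔ (M₁ ℕ.⊔ M₂) ℕ.≤ n → M₁ ℕ.≤ n
          ≤M₁ = ℕ.m⊔n≤o⇒m≤o M₁ M₂ ∘ ℕ.m⊔n≤o⇒n≤o (N₁ ℕ.⊔ N₂) (M₁ ℕ.⊔ M₂)
          ≤M₂ : ∀ {n} → (N₁ ℕ.⊔ N₂) ℕ.⊔ (M₁ ℕ.⊔ M₂) ℕ.≤ n → M₂ ℕ.≤ n
          ≤M₂ = ℕ.m⊔n≤o⇒n≤o M₁ M₂ ∘ ℕ.m⊔n≤o⇒n≤o (N₁ ℕ.⊔ N₂) (M₁ ℕ.⊔ M₂)

    BoundedAway⇒¬Null : BoundedAway f → ¬ Null f
    BoundedAway⇒¬Null (ε , 0<ε , N , ε≤) null with M , <ε ← null 0<ε =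
      ℚ.<-irrefl refl
        (ℚ.≤-<-trans (ε≤ (N ℕ.⊔ M) (ℕ.m≤m⊔n N M)) (<ε (N ℕ.⊔ M) (ℕ.m≤n⊔m N M)))

    BoundedAway-swap : BoundedAway (λ n → f n - g n) → BoundedAway (λ n → g n - f n)
    BoundedAway-swap {f} {g} (ε , 0<ε , F) =
      ε , 0<ε , weaken (λ n → subst (ε ≤_) (∣-∣-comm (f n) (g n))) F

    BoundedAway-resp : (∀ n → f n ≡ g n) → BoundedAway f → BoundedAway g
    BoundedAway-resp f≡g (ε , 0<ε , F) =
      ε , 0<ε , weaken (λ n → subst (λ z → ε ≤ ∣ z ∣) (f≡g n)) F

    persist : ∀ {δ M} → 0ℚ < δ → (∀ n → M ℕ.≤ n → ∣ f M - f n ∣ < ½ * δ) →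
              δ ≤ ∣ f M ∣ → BoundedAway f
    persist {f} {δ} {M} 0<δ near δ≤ = ½ * δ , 0<½* 0<δ , M , λ n M≤n →
      ℚ.≮⇒≥ λ fn< → ℚ.<-irrefl refl (ℚ.≤-<-trans δ≤
        (subst (λ z → ∣ z ∣ < δ) (b+[a-b]≡a (f M) (f n)) (+-small fn< (near n M≤n))))

    BoundedAway-+ : Cauchy f → Cauchy g → BoundedAway (λ n → f n + g n) →
                    BoundedAway f ⊎ BoundedAway g
    BoundedAway-+ {f} {g} F G (ε , 0<ε , N , ε≤)
      with N₁ , p ← F (0<½* (0<½* 0<ε)) | N₂ , q ← G (0<½* (0<½* 0<ε)) = split
      where
      M : ℕ
      M = N ℕ.⊔ (N₁ ℕ.⊔ N₂)
      N₁≤M : N₁ ℕ.≤ M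
      N₁≤M = ℕ.≤-trans (ℕ.m≤m⊔n N₁ N₂) (ℕ.m≤n⊔m N (N₁ ℕ.⊔ N₂))
      N₂≤M : N₂ ℕ.≤ M
      N₂≤M = ℕ.≤-trans (ℕ.m≤n⊔m N₁ N₂) (ℕ.m≤n⊔m N (N₁ ℕ.⊔ N₂))
      split : BoundedAway f ⊎ BoundedAway g
      split with ½ * ε ℚ.≤? ∣ f M ∣ | ½ * ε ℚ.≤? ∣ g M ∣
      ... | yes ≤f | _ = inj₁ (persist (0<½* 0<ε) (λ n M≤n → p M n N₁≤M (ℕ.≤-trans N₁≤M M≤n)) ≤f)
      ... | no _ | yes ≤g = inj₂ (persist (0<½* 0<ε) (λ n M≤n → q M n N₂≤M (ℕ.≤-trans N₂≤M M≤n)) ≤g)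
      ... | no ≰f | no ≰g = contradiction
        (ℚ.≤-<-trans (ε≤ M (ℕ.m≤m⊔n N (N₁ ℕ.⊔ N₂))) (+-small (ℚ.≰⇒> ≰f) (ℚ.≰⇒> ≰g)))
        (ℚ.<-irrefl refl)

    ¬BoundedAway⇒Null : Cauchy f → ¬ BoundedAway f → Null f
    ¬BoundedAway⇒Null {f} F ¬away {ε} 0<ε
      with N₁ , p ← F (0<½* 0<ε) | N₂ , q ← F (0<½* (0<½* 0<ε)) = M , small
      where
      M : ℕ
      M = N₁ ℕ.⊔ N₂
      N₁≤M : N₁ ℕ.≤ M
      N₁≤M = ℕ.m≤m⊔n N₁ N₂
      N₂≤M : N₂ ℕ.≤ M
      N₂≤M = ℕ.m≤n⊔m N₁ N₂
      small : ∀ n → M ℕ.≤ n → ∣ f n ∣ < ε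
      small n M≤n with ½ * ε ℚ.≤? ∣ f M ∣
      ... | yes ≤f = contradiction
        (persist (0<½* 0<ε) (λ n M≤n → q M n N₂≤M (ℕ.≤-trans N₂≤M M≤n)) ≤f) ¬away
      ... | no ≰f = subst (λ z → ∣ z ∣ < ε) (b+[a-b]≡a (f n) (f M))
        (+-small (ℚ.≰⇒> ≰f) (p n M (ℕ.≤-trans N₁≤M M≤n) N₁≤M))

    BoundedAway-* : BoundedAway f → BoundedAway g → BoundedAway (λ n → f n * g n)
    BoundedAway-* (c , 0<c , F) (d , 0<d , G) = c * d , *-0< 0<c 0<d , both (λ _ → *-large 0<c) F G

    BoundedAway-*⁻¹ : Bounded f → BoundedAway (λ n → f n * g n) → BoundedAway g
    BoundedAway-*⁻¹ {f} {g} (c , 0<c , F) (ε , 0<ε , H) with δ , 0<δ , refl ← divide ε 0<c 0<ε =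
      δ , 0<δ , both (λ n f≤c cδ≤ → *-cancel-≤ 0<c
        (ℚ.≤-trans cδ≤ (*-bound 0<c f≤c ℚ.≤-refl))) F H

    near-1 : Null (λ n → f n - 1ℚ) → BoundedAway f
    near-1 {f} F = ½ , ℚ.positive⁻¹ ½ , weaken (λ n <½ → ℚ.≮⇒≥ λ f<½ →
        ℚ.<-irrefl refl (1<1 n f<½ <½))
      (F (ℚ.positive⁻¹ ½))
      where
      1<1 : ∀ n → ∣ f n ∣ < ½ → ∣ f n - 1ℚ ∣ < ½ → 1ℚ < 1ℚ
      1<1 n f< f-1< = subst (λ z → ∣ z ∣ < 1ℚ) (b+[a-b]≡a 1ℚ (f n))
        (+-small {ε = 1ℚ} f< (subst (_< ½) (∣-∣-comm (f n) 1ℚ) f-1<))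

    BoundedAway-sumOfSquares : BoundedAway f ⊎ BoundedAway g →
                               BoundedAway (λ n → f n * f n + g n * g n)
    BoundedAway-sumOfSquares {f} {g} (inj₁ F) with ε , 0<ε , E ← BoundedAway-* {f} {f} F F =
      ε , 0<ε , weaken (λ n → square-+ (f n) (g n)) E
    BoundedAway-sumOfSquares {f} {g} (inj₂ G) =
      BoundedAway-resp (λ n → ℚ.+-comm (g n * g n) (f n * f n))
        (BoundedAway-sumOfSquares {g} {f} (inj₁ G))

    Cauchy-recip : Cauchy f → BoundedAway f → Cauchy (recip ∘ f)
    Cauchy-recip {f} F (c , 0<c , N , c≤) {ε} 0<ε
      with d , 0<d , cd ← divide 1ℚ 0<c 0<1
      with δ , 0<δ , refl ← divide ε (*-0< 0<d 0<d) 0<ε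
      with M , near ← F 0<δ = N ℕ.⊔ M , λ m n ≤m ≤n →
        let N≤m = ℕ.m⊔n≤o⇒m≤o N M ≤m ; N≤n = ℕ.m⊔n≤o⇒m≤o N M ≤n in
        subst (λ z → ∣ z ∣ < d * d * δ) (eq m n N≤m N≤n)
          (*-small (*-0< 0<d 0<d) (*-bound 0<d (recip≤ m N≤m) (recip≤ n N≤n))
            (near n m (ℕ.m⊔n≤o⇒n≤o N M ≤n) (ℕ.m⊔n≤o⇒n≤o N M ≤m)))
      where
      inverse : ∀ n → N ℕ.≤ n → f n * recip (f n) ≡ 1ℚ
      inverse n N≤n = recip-inverse (≢0 0<c (c≤ n N≤n))
      recip≤ : ∀ n → N ℕ.≤ n → ∣ recip (f n) ∣ ≤ d
      recip≤ n N≤n = *-cancel-≤ 0<c (subst (c * ∣ recip (f n) ∣ ≤_)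
        (trans (sym (ℚ.∣p*q∣≡∣p∣*∣q∣ (f n) (recip (f n)))) (trans (cong ∣_∣ (inverse n N≤n)) (sym cd)))
        (ℚ.*-monoʳ-≤-nonNeg ∣ recip (f n) ∣ {{ℚ.∣-∣-nonNeg (recip (f n))}} (c≤ n N≤n)))
      expand : ∀ a b u v → u * v * (b - a) ≡ u * (b * v) - v * (a * u)
      expand = Solver.solve-∀ ring
      eq : ∀ m n → N ℕ.≤ m → N ℕ.≤ n →
           recip (f m) * recip (f n) * (f n - f m) ≡ recip (f m) - recip (f n)
      eq m n N≤m N≤n = trans (expand (f m) (f n) (recip (f m)) (recip (f n)))
        (cong₂ _-_
          (trans (cong (recip (f m) *_) (inverse n N≤n)) (ℚ.*-identityʳ (recip (f m))))
          (trans (cong (recip (f n) *_) (inverse m N≤m)) (ℚ.*-identityʳ (recip (f n)))))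

    Null-recip : BoundedAway f → Null (λ n → f n * recip (f n) - 1ℚ)
    Null-recip (c , 0<c , N , c≤) {ε} 0<ε = N , λ n N≤n →
      subst (λ z → ∣ z - 1ℚ ∣ < ε) (sym (recip-inverse (≢0 0<c (c≤ n N≤n)))) 0<ε

fromℕ : ∀ {c ℓ₁ ℓ₂} (K : HeytingField c ℓ₁ ℓ₂) → ℕ → HeytingField.Carrier K
fromℕ K n = n ×′ 1#
  where
  open HeytingField K
  open HeytingCommutativeRing heytingCommutativeRing using (commutativeRing)
  open CommutativeRing commutativeRing using (+-monoid)
  open Mult +-monoid renaming (_×_ to _×′_)

CharacteristicZero : ∀ {c ℓ₁ ℓ₂} → HeytingField c ℓ₁ ℓ₂ → Set ℓ₂
CharacteristicZero K = ∀ n → fromℕ K (suc n) # 0#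
  where open HeytingField K

module Expressions {c ℓ₁ ℓ₂} (K : HeytingField c ℓ₁ ℓ₂) (char0 : CharacteristicZero K) where

  open HeytingField K public
    using (Carrier; _≈_; _#_; _+_; _*_; -_; _-_; 0#; 1#)
  open HeytingField K
    using (heytingCommutativeRing; #⇒invertible; setoid; +-cong; +-congˡ; +-congʳ; +-assoc; +-comm;
           +-identityˡ; +-identityʳ; *-identityˡ)
    renaming (refl to ≈-refl; sym to ≈-sym; trans to ≈-trans)
  open HeytingProperties heytingCommutativeRing
  open HeytingCommutativeRing heytingCommutativeRing using (commutativeRing)
  open CommutativeRing commutativeRing using (semiring; +-monoid; +-group)
  open GroupProperties +-group
    using (//-rightDividesˡ; //-rightDividesʳ; ⁻¹-anti-homo-//)
  open Exp semiring public using (_^_)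
  open Sums semiring public using (sum-syntax; sum⁺-syntax)
  open SetoidReasoning setoid

  infixl 7 _/_[_]
  infix 4 _∉⟦_,_⟧

  ι : ℕ → Carrier
  ι = fromℕ K

  fromℤ : ℤ → Carrier
  fromℤ (+ n) = ι n
  fromℤ -[1+ n ] = - ι (suc n)

  -- u ∉ {a, a+1, …, b}, with "different from" read as "apart from": in a Heyting field the
  -- reciprocal of u exists exactly when u # 0#, which is stronger than ¬ (u ≈ 0#).
  _∉⟦_,_⟧ : Carrier → ℤ → ℤ → Set ℓ₂
  u ∉⟦ a , b ⟧ = ∀ k → a ℤ.≤ k → k ℤ.≤ b → u # fromℤ k

  -- The quotient does not depend, up to _≈_, on the proof that the denominator is invertible.
  _/_[_] : (u v : Carrier) → v # 0# → Carrier
  u / v [ v#0 ] = u * proj₁ (#⇒invertible v#0)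

  ^-#0 : ∀ {u} n → u # 0# → u ^ n # 0#
  ^-#0 zero u#0 = 1#0
  ^-#0 (suc n) u#0 = x#0y#0→xy#0 u#0 (^-#0 n u#0)

  ι-#0 : ∀ n .{{_ : ℕ.NonZero n}} → ι n # 0#
  ι-#0 (suc n) = char0 n

  -- u (u - 1) ⋯ (u - k + 1)
  falling : Carrier → ℕ → Carrier
  falling u zero = 1#
  falling u (suc k) = falling u k * (u - ι k)

  binom : Carrier → ℕ → Carrier
  binom u k = falling u k / ι (k !) [ ι-#0 (k !) {{k ℕ.!≢0}} ]

  /-#0 : ∀ {u v} (v#0 : v # 0#) → u # 0# → u / v [ v#0 ] # 0#
  /-#0 {u} {v} v#0 u#0 with v⁻¹ , v⁻¹*v≈1 , v*v⁻¹≈1 ← #⇒invertible v#0 =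
    x#0y#0→xy#0 u#0 (invertibleˡ⇒# (v - 0# , ≈-trans (HeytingField.*-congˡ K (x-0≈x v⁻¹)) v*v⁻¹≈1))

  #⇒-#0 : ∀ {u v} → u # v → u - v # 0#
  #⇒-#0 {u} {v} u#v with w , w*d≈1 , _ ← #⇒invertible u#v =
    invertibleˡ⇒# (w , ≈-trans (HeytingField.*-congˡ K (x-0≈x (u - v))) w*d≈1)

  falling-#0 : ∀ u k → (∀ j → j ℕ.< k → u - ι j # 0#) → falling u k # 0#
  falling-#0 u zero h = 1#0
  falling-#0 u (suc k) h =
    x#0y#0→xy#0 (falling-#0 u k (λ j j<k → h j (ℕ.m<n⇒m<1+n j<k))) (h k ℕ.≤-refl)

  -+-cancel : ∀ u v → u - v + v ≈ u
  -+-cancel u v = //-rightDividesˡ v u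

  fromℤ-⊖ : ∀ m n → fromℤ (m ⊖ n) ≈ ι m - ι n
  fromℤ-⊖ m zero = ≈-sym (x-0≈x (ι m))
  fromℤ-⊖ zero (suc n) = ≈-sym (+-identityˡ (- ι (suc n)))
  fromℤ-⊖ (suc m) (suc n) = begin
    fromℤ (suc m ⊖ suc n)                    ≡⟨ cong fromℤ (ℤ.[1+m]⊖[1+n]≡m⊖n m n) ⟩
    fromℤ (m ⊖ n)                            ≈⟨ fromℤ-⊖ m n ⟩
    ι m - ι n                                ≈⟨ //-rightDividesʳ (ι (suc n)) (ι m - ι n) ⟨
    ι m - ι n + (1# + ι n) - ι (suc n)       ≈⟨ +-congʳ (+-congˡ (+-comm 1# (ι n))) ⟩
    ι m - ι n + (ι n + 1#) - ι (suc n)       ≈⟨ +-congʳ (+-assoc (ι m - ι n) (ι n) 1#) ⟨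
    ι m - ι n + ι n + 1# - ι (suc n)         ≈⟨ +-congʳ (+-congʳ (-+-cancel (ι m) (ι n))) ⟩
    ι m + 1# - ι (suc n)                     ≈⟨ +-congʳ (+-comm (ι m) 1#) ⟩
    ι (suc m) - ι (suc n)                    ∎

  ⊖-≤-⊖ : ∀ p q r s → p ℕ.+ s ℕ.≤ r ℕ.+ q → p ⊖ q ℤ.≤ r ⊖ s
  ⊖-≤-⊖ p q r s p+s≤r+q = subst₂ ℤ._≤_
    (trans (cong (_⊖ (s ℕ.+ q)) (ℕ.+-comm p s)) (ℤ.+-cancelˡ-⊖ s p q))
    (trans (cong₂ _⊖_ (ℕ.+-comm r q) (ℕ.+-comm s q)) (ℤ.+-cancelˡ-⊖ q r s))
    (ℤ.⊖-monoˡ-≤ (s ℕ.+ q) p+s≤r+q)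

  -n≤ : ∀ n m k → k ℕ.≤ m ℕ.+ n → ℤ.- + n ℤ.≤ m ⊖ k
  -n≤ n m k k≤m+n = subst (ℤ._≤ m ⊖ k) (0⊖n n) (⊖-≤-⊖ 0 n m k k≤m+n)
    where
    0⊖n : ∀ n → 0 ⊖ n ≡ ℤ.- + n
    0⊖n zero = refl
    0⊖n (suc n) = refl

  avoids : ∀ {u v a b} → u ∉⟦ a , b ⟧ → ∀ m k → a ℤ.≤ m ⊖ k → m ⊖ k ℤ.≤ b →
           v + ι m ≈ u + ι k → v # 0#
  avoids {u} {v} u∉ m k a≤ ≤b eq = #-congʳ u-k≈v (#⇒-#0 (u∉ (m ⊖ k) a≤ ≤b))
    where
    u-k≈v : u - fromℤ (m ⊖ k) ≈ v
    u-k≈v = begin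
      u - fromℤ (m ⊖ k)      ≈⟨ +-congˡ (HeytingField.-‿cong K (fromℤ-⊖ m k)) ⟩
      u - (ι m - ι k)        ≈⟨ +-congˡ (⁻¹-anti-homo-// (ι m) (ι k)) ⟩
      u + (ι k - ι m)        ≈⟨ +-assoc u (ι k) (- ι m) ⟨
      u + ι k - ι m          ≈⟨ +-congʳ eq ⟨
      v + ι m - ι m          ≈⟨ //-rightDividesʳ (ι m) v ⟩
      v                      ∎

  ι1≈1 : ι 1 ≈ 1#
  ι1≈1 = +-identityʳ 1#

  n-1#0 : ∀ {n} → 2 ℕ.≤ n → ι n - 1# # 0#
  n-1#0 (s≤s {n = suc m} (s≤s _)) = #-congʳ (begin
    ι (suc m)                ≈⟨ //-rightDividesʳ 1# (ι (suc m)) ⟨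
    ι (suc m) + 1# - 1#      ≈⟨ +-congʳ (+-comm (ι (suc m)) 1#) ⟩
    1# + ι (suc m) - 1#      ∎) (char0 m)

  binom-#0 : ∀ u k → (∀ j → j ℕ.< k → u - ι j # 0#) → binom u k # 0#
  binom-#0 u k h = /-#0 (ι-#0 (k !) {{k ℕ.!≢0}}) (falling-#0 u k h)

  +k#0 : ∀ {n u} → u ∉⟦ ℤ.- + n , -1ℤ ⟧ → (i : Fin n) → u + ι (suc (toℕ i)) # 0#
  +k#0 {n} {u} u∉ i = avoids u∉ 0 k (-n≤ n 0 k (Fin.toℕ<n i)) (⊖-≤-⊖ 0 k 0 1 (s≤s z≤n))
    (+-identityʳ (u + ι k))
    where k = suc (toℕ i)

  -- H ℓ n u is the sum of 1 / (u + k)^ℓ over k = 1, …, n; the index i stands for k - 1.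
  H : (ℓ n : ℕ) (u : Carrier) → u ∉⟦ ℤ.- + n , -1ℤ ⟧ → Carrier
  H ℓ n u u∉ = ∑[ i < n ] (1# / (u + ι (suc (toℕ i))) ^ ℓ [ ^-#0 ℓ (+k#0 u∉ i) ])

  module Setup
    (n : ℕ) (2≤n : 2 ℕ.≤ n) (x y : Carrier)
    (x∉ : x ∉⟦ ℤ.- + n , -1ℤ ⟧) (x-y∉ : x - y ∉⟦ ℤ.- + n , -1ℤ ⟧)
    (y∉ : y ∉⟦ ℤ.- + n , + n ℤ.- 1ℤ ⟧)
    where

    private
      1≤n : 1 ℕ.≤ n
      1≤n = ℕ.≤-trans (s≤s z≤n) 2≤n

    x∉-upTo : (k : Fin (suc n)) → x ∉⟦ ℤ.- + toℕ k , -1ℤ ⟧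
    x∉-upTo k j -k≤j = x∉ j (ℤ.≤-trans (ℤ.neg-mono-≤ (ℤ.+≤+ (Fin.toℕ≤pred[n] k))) -k≤j)

    1+x-y#0 : 1# + x - y # 0#
    1+x-y#0 = avoids x-y∉ 0 1 (-n≤ n 0 1 1≤n) ℤ.≤-refl (begin
      1# + x - y + 0#    ≈⟨ +-identityʳ (1# + x - y) ⟩
      1# + x - y         ≈⟨ +-assoc 1# x (- y) ⟩
      1# + (x - y)       ≈⟨ +-comm 1# (x - y) ⟩
      x - y + 1#         ≈⟨ +-congˡ ι1≈1 ⟨
      x - y + ι 1        ∎)

    y+k#0 : (k : Fin (suc n)) → y + ι (toℕ k) # 0#
    y+k#0 k = avoids y∉ 0 (toℕ k) (-n≤ n 0 (toℕ k) (Fin.toℕ≤pred[n] k))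
      (⊖-≤-⊖ 0 (toℕ k) n 1 (ℕ.≤-trans 1≤n (ℕ.m≤m+n n (toℕ k))))
      (+-identityʳ (y + ι (toℕ k)))

    y+k-1#0 : (k : Fin (suc n)) → y + ι (toℕ k) - 1# # 0#
    y+k-1#0 k = avoids y∉ 1 (toℕ k) (-n≤ n 1 (toℕ k) (ℕ.m≤n⇒m≤1+n (Fin.toℕ≤pred[n] k)))
      (⊖-≤-⊖ 1 (toℕ k) n 1 (ℕ.≤-trans 2≤n (ℕ.m≤m+n n (toℕ k))))
      (≈-trans (+-congˡ ι1≈1) (-+-cancel (y + ι (toℕ k)) 1#))

    binom[y-n+k]#0 : (k : Fin (suc n)) → binom (y - ι n + ι (toℕ k)) (toℕ k) # 0#
    binom[y-n+k]#0 i = binom-#0 (y - ι n + ι k) k λ j j<k →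
      avoids y∉ (n ℕ.+ j) k (-n≤ n (n ℕ.+ j) k (ℕ.≤-trans k≤n (ℕ.m≤n+m n (n ℕ.+ j))))
        (⊖-≤-⊖ (n ℕ.+ j) k n 1
          (subst (ℕ._≤ n ℕ.+ k) (trans (ℕ.+-suc n j) (ℕ.+-comm 1 (n ℕ.+ j))) (ℕ.+-monoʳ-≤ n j<k)))
        (begin
          y - ι n + ι k - ι j + ι (n ℕ.+ j)     ≈⟨ +-congˡ (Mult.×-homo-+ +-monoid 1# n j) ⟩
          y - ι n + ι k - ι j + (ι n + ι j)     ≈⟨ +-congˡ (+-comm (ι n) (ι j)) ⟩
          y - ι n + ι k - ι j + (ι j + ι n)     ≈⟨ +-assoc (y - ι n + ι k - ι j) (ι j) (ι n) ⟨
          y - ι n + ι k - ι j + ι j + ι n       ≈⟨ +-congʳ (-+-cancel (y - ι n + ι k) (ι j)) ⟩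
          y - ι n + ι k + ι n                   ≈⟨ +-assoc (y - ι n) (ι k) (ι n) ⟩
          y - ι n + (ι k + ι n)                 ≈⟨ +-congˡ (+-comm (ι k) (ι n)) ⟩
          y - ι n + (ι n + ι k)                 ≈⟨ +-assoc (y - ι n) (ι n) (ι k) ⟨
          y - ι n + ι n + ι k                   ≈⟨ +-congʳ (-+-cancel y (ι n)) ⟩
          y + ι k                               ∎)
      where
      k = toℕ i
      k≤n = Fin.toℕ≤pred[n] i

    binom[x+n]#0 : binom (x + ι n) n # 0#
    binom[x+n]#0 = binom-#0 (x + ι n) n λ j j<n →
      avoids x∉ j n (-n≤ n j n (ℕ.m≤n+m n j))
        (⊖-≤-⊖ j n 0 1 (subst (ℕ._≤ n) (ℕ.+-comm 1 j) j<n))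
        (-+-cancel (x + ι n) (ι j))

    binom[y]#0 : binom y n # 0#
    binom[y]#0 = binom-#0 y n λ j j<n →
      avoids y∉ j 0 (-n≤ n j 0 z≤n)
        (⊖-≤-⊖ j 0 n 1 (subst₂ ℕ._≤_ (ℕ.+-comm 1 j) (sym (ℕ.+-identityʳ n)) j<n))
        (≈-trans (-+-cancel y (ι j)) (≈-sym (+-identityʳ y)))

    6n[n-1][1+x-y]#0 : ι 6 * ι n * (ι n - 1#) * (1# + x - y) # 0#
    6n[n-1][1+x-y]#0 = x#0y#0→xy#0
      (x#0y#0→xy#0 (x#0y#0→xy#0 (ι-#0 6) (ι-#0 n {{ℕ.>-nonZero 1≤n}})) (n-1#0 2≤n))
      1+x-y#0

    [y+k-1][y+k]#0 : (k : Fin (suc n)) → (y + ι (toℕ k) - 1#) * (y + ι (toℕ k)) # 0#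
    [y+k-1][y+k]#0 k = x#0y#0→xy#0 (y+k-1#0 k) (y+k#0 k)

    binom[x+n]binom[y]#0 : binom (x + ι n) n * binom y n # 0#
    binom[x+n]binom[y]#0 = x#0y#0→xy#0 binom[x+n]#0 binom[y]#0

    Δ : ℕ → Carrier
    Δ ℓ = H ℓ n x x∉ - H ℓ n (x - y) x-y∉

    E : Carrier
    E = Δ 1 ^ 3 + ι 2 * Δ 3 + ι 3 * Δ 1 * Δ 2

    F : Carrier
    F = Δ 1 ^ 2 + Δ 2

    G : Carrier
    G = (ι 6 * ι n * y / (1# + x - y) ^ 2 [ ^-#0 2 1+x-y#0 ]) * Δ 1
      + (ι 6 * ι n * y / (1# + x - y) ^ 3 [ ^-#0 3 1+x-y#0 ])

module Reals where

  open import Data.Rational.Base using (_+_; _*_; _-_; -_)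
  open RationalEstimates
  open Sequences

  -- Cauchy sequences of rationals; _≃_ identifies sequences whose difference tends to 0, and
  -- _#ᴿ_ is the apartness: the difference is eventually bounded away from 0.
  record ℝ : Set where
    constructor mkℝ
    field
      seq : ℕ → ℚ
      cauchy : Cauchy seq

  open ℝ public

  infix 4 _≃_ _#ᴿ_
  infixl 6 _+ᴿ_
  infixl 7 _*ᴿ_
  infix 8 -ᴿ_

  record _≃_ (x y : ℝ) : Set where
    constructor mk≃
    field null : Null (λ n → seq x n - seq y n)

  open _≃_ public

  record _#ᴿ_ (x y : ℝ) : Set where
    constructor mk#
    field away : BoundedAway (λ n → seq x n - seq y n)

  open _#ᴿ_ public

  constᴿ : ℚ → ℝ
  constᴿ q = mkℝ (λ _ → q) (Cauchy-const q)

  _+ᴿ_ : ℝ → ℝ → ℝ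
  x +ᴿ y = mkℝ (λ n → seq x n + seq y n) (Cauchy-+ {seq x} {seq y} (cauchy x) (cauchy y))

  _*ᴿ_ : ℝ → ℝ → ℝ
  x *ᴿ y = mkℝ (λ n → seq x n * seq y n) (Cauchy-* {seq x} {seq y} (cauchy x) (cauchy y))

  -ᴿ_ : ℝ → ℝ
  -ᴿ x = mkℝ (λ n → - seq x n) (Cauchy-neg {seq x} (cauchy x))

  recipᴿ : (x : ℝ) → BoundedAway (seq x) → ℝ
  recipᴿ x x-away = mkℝ (recip ∘ seq x) (Cauchy-recip {seq x} (cauchy x) x-away)

  private variable x x′ y y′ z : ℝ

  pointwise : (∀ n → seq x n ≡ seq y n) → x ≃ y
  pointwise {x} {y} eq = mk≃ (Null-0 λ n →
    trans (cong (_- seq y n) (eq n)) (ℚ.+-inverseʳ (seq y n)))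

  ≃-refl : x ≃ x
  ≃-refl {x} = pointwise {x} {x} λ _ → refl

  ≃-sym : x ≃ y → y ≃ x
  ≃-sym {x} {y} (mk≃ e) = mk≃ (Null-resp (λ n → eq (seq x n) (seq y n)) (Null-neg e))
    where
    eq : ∀ a b → - (a - b) ≡ b - a
    eq = Solver.solve-∀ ring

  ≃-trans : x ≃ y → y ≃ z → x ≃ z
  ≃-trans {x} {y} {z} (mk≃ d) (mk≃ e) =
    mk≃ (Null-resp (λ n → eq (seq x n) (seq y n) (seq z n)) (Null-+ d e))
    where
    eq : ∀ a b c → (a - b) + (b - c) ≡ a - c
    eq = Solver.solve-∀ ring

  +ᴿ-cong : x ≃ x′ → y ≃ y′ → x +ᴿ y ≃ x′ +ᴿ y′
  +ᴿ-cong {x} {x′} {y} {y′} (mk≃ d) (mk≃ e) =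
    mk≃ (Null-resp (λ n → eq (seq x n) (seq x′ n) (seq y n) (seq y′ n)) (Null-+ d e))
    where
    eq : ∀ a b c d → (a - b) + (c - d) ≡ (a + c) - (b + d)
    eq = Solver.solve-∀ ring

  *ᴿ-cong : x ≃ x′ → y ≃ y′ → x *ᴿ y ≃ x′ *ᴿ y′
  *ᴿ-cong {x} {x′} {y} {y′} (mk≃ d) (mk≃ e) =
    mk≃ (Null-resp (λ n → eq (seq x n) (seq x′ n) (seq y n) (seq y′ n))
      (Null-+ (Null-* (Cauchy⇒Bounded {seq x} (cauchy x)) e)
              (Null-* (Cauchy⇒Bounded {seq y′} (cauchy y′)) d)))
    where
    eq : ∀ a b c d → a * (c - d) + d * (a - b) ≡ a * c - b * d
    eq = Solver.solve-∀ ring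

  -ᴿ-cong : x ≃ y → -ᴿ x ≃ -ᴿ y
  -ᴿ-cong {x} {y} (mk≃ e) =
    mk≃ (Null-resp (λ n → ℚ.neg-distrib-+ (seq x n) (- seq y n)) (Null-neg e))

  #ᴿ-irrefl : x ≃ y → ¬ (x #ᴿ y)
  #ᴿ-irrefl (mk≃ e) (mk# a) = BoundedAway⇒¬Null a e

  #ᴿ-sym : x #ᴿ y → y #ᴿ x
  #ᴿ-sym {x} {y} (mk# a) = mk# (BoundedAway-swap {seq x} {seq y} a)

  #ᴿ-cotrans : x #ᴿ y → ∀ z → x #ᴿ z ⊎ z #ᴿ y
  #ᴿ-cotrans {x} {y} (mk# a) z = Sum.map mk# mk#
    (BoundedAway-+ (cauchy (x +ᴿ -ᴿ z)) (cauchy (z +ᴿ -ᴿ y))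
      (BoundedAway-resp (λ n → eq (seq x n) (seq y n) (seq z n)) a))
    where
    eq : ∀ a b c → a - b ≡ (a - c) + (c - b)
    eq = Solver.solve-∀ ring

  #ᴿ-tight : ∀ x y → ¬ (x #ᴿ y) → x ≃ y
  #ᴿ-tight x y ¬x#y = mk≃ (¬BoundedAway⇒Null (cauchy (x +ᴿ -ᴿ y)) (¬x#y ∘ mk#))

module ComplexIdentities where
  open RationalEstimates using (ring)
  open import Data.Rational.Base using (_+_; _*_; -_)
  assoc-re : ∀ a b c d e f →
    (a * c + - (b * d)) * e + - ((a * d + b * c) * f) ≡
    a * (c * e + - (d * f)) + - (b * (c * f + d * e))
  assoc-re = Solver.solve-∀ ring
  assoc-im : ∀ a b c d e f →
    (a * c + - (b * d)) * f + (a * d + b * c) * e ≡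
    a * (c * f + d * e) + b * (c * e + - (d * f))
  assoc-im = Solver.solve-∀ ring
  distrib-re : ∀ a b c d e f →
    a * (c + e) + - (b * (d + f)) ≡ (a * c + - (b * d)) + (a * e + - (b * f))
  distrib-re = Solver.solve-∀ ring
  distrib-im : ∀ a b c d e f →
    a * (d + f) + b * (c + e) ≡ (a * d + b * c) + (a * f + b * e)
  distrib-im = Solver.solve-∀ ring
  comm-re : ∀ a b c d → a * c + - (b * d) ≡ c * a + - (d * b)
  comm-re = Solver.solve-∀ ring
  comm-im : ∀ a b c d → a * d + b * c ≡ c * b + d * a
  comm-im = Solver.solve-∀ ring
  identity-re : ∀ a b → 1ℚ * a + - (0ℚ * b) ≡ a
  identity-re = Solver.solve-∀ ring
  identity-im : ∀ a b → 1ℚ * b + 0ℚ * a ≡ b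
  identity-im = Solver.solve-∀ ring
  inverse-re : ∀ a b r → (a * a + b * b) * r + - 1ℚ ≡ a * r * a + - (- b * r * b) + - 1ℚ
  inverse-re = Solver.solve-∀ ring
  inverse-im : ∀ a b r → a * r * b + - b * r * a ≡ 0ℚ
  inverse-im = Solver.solve-∀ ring

module Complex where

  open Reals
  open RationalEstimates using (0<1)
  open Sequences

  infix 4 _≈_ _#_
  infixl 6 _+_
  infixl 7 _*_
  infix 8 -_

  record ℂ : Set where
    constructor _+i_
    field
      re : ℝ
      im : ℝ

  open ℂ public

  record _≈_ (z w : ℂ) : Set where
    constructor mk≈
    field
      re≃ : re z ≃ re w
      im≃ : im z ≃ im w

  data _#_ (z w : ℂ) : Set where
    re# : re z #ᴿ re w → z # w
    im# : im z #ᴿ im w → z # w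

  _+_ _*_ : ℂ → ℂ → ℂ
  z + w = (re z +ᴿ re w) +i (im z +ᴿ im w)
  z * w = (re z *ᴿ re w +ᴿ -ᴿ (im z *ᴿ im w)) +i (re z *ᴿ im w +ᴿ im z *ᴿ re w)

  -_ : ℂ → ℂ
  - z = (-ᴿ re z) +i (-ᴿ im z)

  0ᶜ 1ᶜ : ℂ
  0ᶜ = constᴿ 0ℚ +i constᴿ 0ℚ
  1ᶜ = constᴿ 1ℚ +i constᴿ 0ℚ

  private

    pointwiseᶜ : ∀ {z w} → (∀ n → seq (re z) n ≡ seq (re w) n) →
                 (∀ n → seq (im z) n ≡ seq (im w) n) → z ≈ w
    pointwiseᶜ {z} {w} r i = mk≈ (pointwise {re z} {re w} r) (pointwise {im z} {im w} i)

    open ComplexIdentities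

    re[_] im[_] : ℂ → ℕ → ℚ
    re[ z ] = seq (re z)
    im[ z ] = seq (im z)

    *-comm : ∀ z w → z * w ≈ w * z
    *-comm z w = pointwiseᶜ
      (λ n → comm-re (re[ z ] n) (im[ z ] n) (re[ w ] n) (im[ w ] n))
      (λ n → comm-im (re[ z ] n) (im[ z ] n) (re[ w ] n) (im[ w ] n))

    *-assoc : ∀ z w v → (z * w) * v ≈ z * (w * v)
    *-assoc z w v = pointwiseᶜ
      (λ n → assoc-re (re[ z ] n) (im[ z ] n) (re[ w ] n) (im[ w ] n) (re[ v ] n) (im[ v ] n))
      (λ n → assoc-im (re[ z ] n) (im[ z ] n) (re[ w ] n) (im[ w ] n) (re[ v ] n) (im[ v ] n))

    *-distribˡ-+ : ∀ z w v → z * (w + v) ≈ z * w + z * v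
    *-distribˡ-+ z w v = pointwiseᶜ
      (λ n → distrib-re (re[ z ] n) (im[ z ] n) (re[ w ] n) (im[ w ] n) (re[ v ] n) (im[ v ] n))
      (λ n → distrib-im (re[ z ] n) (im[ z ] n) (re[ w ] n) (im[ w ] n) (re[ v ] n) (im[ v ] n))

    *-identityˡ : ∀ z → 1ᶜ * z ≈ z
    *-identityˡ z = pointwiseᶜ
      (λ n → identity-re (re[ z ] n) (im[ z ] n))
      (λ n → identity-im (re[ z ] n) (im[ z ] n))

    ≈-trans : ∀ {z w v} → z ≈ w → w ≈ v → z ≈ v
    ≈-trans (mk≈ a b) (mk≈ c d) = mk≈ (≃-trans a c) (≃-trans b d)

    +-cong : ∀ {z z′ w w′} → z ≈ z′ → w ≈ w′ → z + w ≈ z′ + w′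
    +-cong (mk≈ a b) (mk≈ c d) = mk≈ (+ᴿ-cong a c) (+ᴿ-cong b d)

    *-distribʳ-+ : ∀ z w v → (w + v) * z ≈ w * z + v * z
    *-distribʳ-+ z w v = ≈-trans (*-comm (w + v) z)
      (≈-trans (*-distribˡ-+ z w v)
        (+-cong {z * w} {w * z} {z * v} {v * z} (*-comm z w) (*-comm z v)))

    -- The inverse of a + i b is (a - i b) / (a² + b²).
    invertible : ∀ {z w} → z # w → ∃[ v ] v * (z + - w) ≈ 1ᶜ × (z + - w) * v ≈ 1ᶜ
    invertible {z} {w} z#w = d⁻¹ , d⁻¹*d≈1 , ≈-trans (*-comm d d⁻¹) d⁻¹*d≈1
      where
      d = z + - w
      a = re d
      b = im d
      ∣d∣² = a *ᴿ a +ᴿ b *ᴿ b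
      parts : z # w → BoundedAway (seq a) ⊎ BoundedAway (seq b)
      parts (re# p) = inj₁ (away p)
      parts (im# p) = inj₂ (away p)
      ∣d∣²-away : BoundedAway (seq ∣d∣²)
      ∣d∣²-away = BoundedAway-sumOfSquares {seq a} {seq b} (parts z#w)
      r = recipᴿ ∣d∣² ∣d∣²-away
      d⁻¹ = (a *ᴿ r) +i (-ᴿ b *ᴿ r)
      d⁻¹*d≈1 : d⁻¹ * d ≈ 1ᶜ
      d⁻¹*d≈1 = mk≈
        (mk≃ (Null-resp (λ n → inverse-re (seq a n) (seq b n) (seq r n)) (Null-recip ∣d∣²-away)))
        (pointwise {im (d⁻¹ * d)} {im 1ᶜ} (λ n → inverse-im (seq a n) (seq b n) (seq r n)))

    factor# : ∀ {z w v} → v * (z + - w) ≈ 1ᶜ → z # w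
    factor# {z} {w} {v} (mk≈ e _) = [ re# ∘ mk# ∘ BoundedAway-*⁻¹ (bounded (re v))
                                    , im# ∘ mk# ∘ BoundedAway-*⁻¹ (bounded (-ᴿ im v)) ]′
      (BoundedAway-+ (cauchy (re v *ᴿ a)) (cauchy (-ᴿ im v *ᴿ b))
        (BoundedAway-resp (λ n → cong (seq (re v *ᴿ a) n ℚ.+_) (ℚ.neg-distribˡ-* (seq (im v) n) (seq b n)))
          (near-1 (null e))))
      where
      a = re (z + - w)
      b = im (z + - w)
      bounded : ∀ x → Bounded (seq x)
      bounded x = Cauchy⇒Bounded {seq x} (cauchy x)

    cotrans : ∀ {z w} → z # w → ∀ v → z # v ⊎ v # w
    cotrans (re# p) v = Sum.map re# re# (#ᴿ-cotrans p (re v))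
    cotrans (im# p) v = Sum.map im# im# (#ᴿ-cotrans p (im v))

    irrefl : ∀ {z w} → z ≈ w → ¬ (z # w)
    irrefl (mk≈ p _) (re# a) = #ᴿ-irrefl p a
    irrefl (mk≈ _ q) (im# a) = #ᴿ-irrefl q a

    #-sym : ∀ {z w} → z # w → w # z
    #-sym (re# p) = re# (#ᴿ-sym p)
    #-sym (im# p) = im# (#ᴿ-sym p)

  ℂ-heytingField : HeytingField 0ℓ 0ℓ 0ℓ
  ℂ-heytingField = record
    { Carrier = ℂ
    ; _≈_ = _≈_
    ; _#_ = _#_
    ; _+_ = _+_
    ; _*_ = _*_
    ; -_ = -_
    ; 0# = 0ᶜ
    ; 1# = 1ᶜ
    ; isHeytingField = record
      { isHeytingCommutativeRing = record
        { isCommutativeRing = record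
          { isRing = record
            { +-isAbelianGroup = record
              { isGroup = record
                { isMonoid = record
                  { isSemigroup = record
                    { isMagma = record
                      { isEquivalence = record
                        { refl = mk≈ ≃-refl ≃-refl
                        ; sym = λ (mk≈ p q) → mk≈ (≃-sym p) (≃-sym q)
                        ; trans = ≈-trans
                        }
                      ; ∙-cong = +-cong
                      }
                    ; assoc = λ z w v → pointwiseᶜ
                        (λ n → ℚ.+-assoc (re[ z ] n) (re[ w ] n) (re[ v ] n))
                        (λ n → ℚ.+-assoc (im[ z ] n) (im[ w ] n) (im[ v ] n))
                    }
                  ; identity =
                      (λ z → pointwiseᶜ (λ n → ℚ.+-identityˡ (re[ z ] n)) (λ n → ℚ.+-identityˡ (im[ z ] n))) ,
                      (λ z → pointwiseᶜ (λ n → ℚ.+-identityʳ (re[ z ] n)) (λ n → ℚ.+-identityʳ (im[ z ] n)))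
                  }
                ; inverse =
                    (λ z → pointwiseᶜ (λ n → ℚ.+-inverseˡ (re[ z ] n)) (λ n → ℚ.+-inverseˡ (im[ z ] n))) ,
                    (λ z → pointwiseᶜ (λ n → ℚ.+-inverseʳ (re[ z ] n)) (λ n → ℚ.+-inverseʳ (im[ z ] n)))
                ; ⁻¹-cong = λ (mk≈ p q) → mk≈ (-ᴿ-cong p) (-ᴿ-cong q)
                }
              ; comm = λ z w → pointwiseᶜ
                  (λ n → ℚ.+-comm (re[ z ] n) (re[ w ] n))
                  (λ n → ℚ.+-comm (im[ z ] n) (im[ w ] n))
              }
            ; *-cong = λ (mk≈ a b) (mk≈ c d) → mk≈
                (+ᴿ-cong (*ᴿ-cong a c) (-ᴿ-cong (*ᴿ-cong b d)))
                (+ᴿ-cong (*ᴿ-cong a d) (*ᴿ-cong b c))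
            ; *-assoc = *-assoc
            ; *-identity = *-identityˡ , λ z → ≈-trans (*-comm z 1ᶜ) (*-identityˡ z)
            ; distrib = *-distribˡ-+ , *-distribʳ-+
            }
          ; *-comm = *-comm
          }
        ; isApartnessRelation = record
          { irrefl = irrefl
          ; sym = #-sym
          ; cotrans = cotrans
          }
        ; #⇒invertible = invertible
        ; invertible⇒# = λ {z} {w} (v , v*d≈1 , _) → factor# {z} {w} {v} v*d≈1
        }
      ; tight = λ z w →
          (λ ¬z#w → mk≈ (#ᴿ-tight (re z) (re w) (¬z#w ∘ re#)) (#ᴿ-tight (im z) (im w) (¬z#w ∘ im#))) ,
          irrefl
      }
    }

  ℂ-characteristicZero : CharacteristicZero ℂ-heytingField
  ℂ-characteristicZero n = re# (mk# (1ℚ , 0<1 , 0 , λ k _ → 1≤∣n+1∣ k))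
    where
    q : ℕ → ℕ → ℚ
    q m = seq (re (fromℕ ℂ-heytingField m))
    0≤q : ∀ m k → 0ℚ ℚ.≤ q m k
    0≤q zero k = ℚ.≤-refl
    0≤q (suc m) k = ℚ.+-mono-≤ (ℚ.<⇒≤ 0<1) (0≤q m k)
    1≤q : ∀ k → 1ℚ ℚ.≤ q (suc n) k
    1≤q k = ℚ.+-monoʳ-≤ 1ℚ (0≤q n k)
    1≤∣n+1∣ : ∀ k → 1ℚ ℚ.≤ ∣ q (suc n) k ℚ.- 0ℚ ∣
    1≤∣n+1∣ k = subst (1ℚ ℚ.≤_)
      (trans (sym (ℚ.0≤p⇒∣p∣≡p (ℚ.≤-trans (ℚ.<⇒≤ 0<1) (1≤q k))))
             (cong ∣_∣ (sym (ℚ.+-identityʳ (q (suc n) k)))))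
      (1≤q k)

open Complex public using (ℂ; ℂ-heytingField; ℂ-characteristicZero)
open Expressions ℂ-heytingField ℂ-characteristicZero public

{-# OPTIONS --safe #-}
-- The coefficient of H_k on the left is (-1)^k (n choose k) times a polynomial in k of degree
-- m = n - 2, namely (y - 2 + k) ⋯ (y - n + 1 + k) / ((y - 2) ⋯ (y - n + 1)), so the left side is an
-- n-th finite difference.  Write P = ∏ (x - y + j) / (x + j) over j = 1, …, n.  With harmonic numbers
-- of order 1 in place of order 4, differencing once lowers n and m by one, at the cost of a difference
-- of a polynomial divided by x + 1 + k, which has a closed form; induction on m then evaluates the
-- sum as a multiple of (1 + n y / (1 + x - y)) P - 1.  Order 4 is, up to sign, the coefficient of ε³
-- of order 1 at x + ε modulo ε⁴.  Since the logarithmic derivative of P is H_n(x - y) - H_n(x), the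
-- derivatives of P are -P Δ₁, P F and -P E, which gives the right side.
module Submission where

-- Order 4 is reached through order 1 because a direct induction would meet differences of
-- polynomials divided by (x + 1 + k)⁴, whose values are no longer plain products, whereas division
-- by x + 1 + k itself gives a product. To make the passage to x + ε purely algebraic, the order 1
-- identity is proved over an arbitrary commutative ring. Jets contain the nilpotent ε and form no
-- field, so reciprocals enter as sequences `w`, `b` and an element `q` that satisfy equations such
-- as w j * (x + j + 1) = 1. An identity modulo these equations is certified by an explicit
-- combination of terms u v - 1 that accounts for the difference of its sides; the ring solver then
-- checks a plain polynomial identity. Divisions by 2 and 6 are avoided by stating the Taylor
-- coefficients multiplied by factorials. The element q = 1 / (1 + x - y) appears because the closed
-- form of the extra difference contains the factors x - y + j from j = 2 on, whereas the numerator
-- of P starts at j = 1.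

open import Defs using (CharacteristicZero; module Expressions; ℂ-heytingField; ℂ-characteristicZero)
open import Algebra.Apartness.Bundles using (HeytingCommutativeRing; HeytingField)
open import Algebra.Bundles using (CommutativeRing)
import Algebra.Consequences.Setoid as Consequences
open import Algebra.Definitions
  using (Associative; Commutative; Congruent₂; LeftIdentity; _DistributesOverˡ_)
import Algebra.Properties.AbelianGroup as AbelianGroupProperties
import Algebra.Properties.CommutativeSemigroup as CommutativeSemigroupProperties
import Algebra.Properties.Ring as RingProperties
import Algebra.Properties.Semiring.Exp as Exp
import Algebra.Properties.Semiring.Mult as Mult
import Algebra.Properties.Semiring.Mult.TCOptimised as Mult′
import Algebra.Properties.Semiring.Sum as Sums
import Algebra.Solver.Ring as RingSolver
open import Algebra.Solver.Ring.AlmostCommutativeRing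
  using (fromCommutativeRing; _-Raw-AlmostCommutative⟶_; Induced-equivalence)
open import Data.Fin.Base using (Fin; zero; suc; toℕ)
import Data.Fin.Properties as Fin
open import Data.Integer.Base as ℤ using (ℤ; +_; -[1+_]; _⊖_; -1ℤ; 0ℤ; 1ℤ)
import Data.Integer.Properties as ℤ
import Data.Maybe.Base as Maybe
open import Data.Nat.Base as ℕ using (ℕ; zero; suc; _≤_; _<_; z≤n; s≤s; _!)
import Data.Nat.Properties as ℕ
open import Data.Product.Base using (∃; Σ-syntax; _,_; proj₁; proj₂)
open import Function.Base using (_∘_)
open import Relation.Binary.Bundles using (Setoid)
open import Relation.Binary.Definitions using (WeaklyDecidable)
open import Relation.Binary.PropositionalEquality as ≡ using (_≡_; cong)
import Relation.Binary.Reasoning.Setoid as SetoidReasoning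
open import Relation.Binary.Structures using (IsEquivalence)
open import Relation.Nullary.Decidable.Core using (dec⇒maybe)

-- Ring identities with integer coefficients.

module IntegerSolver {c ℓ} (R : CommutativeRing c ℓ) where

  open CommutativeRing R
  open RingProperties ring using (-0#≈0#; -‿involutive; -‿distribˡ-*; -‿distribʳ-*)
  open AbelianGroupProperties +-abelianGroup using (⁻¹-∙-comm)
  open Mult′ semiring using (_×_; 1+×; ×-homo-+; ×1-homo-*)
  open SetoidReasoning setoid

  private

    -- The optimised multiples make `⟦ + 1 ⟧` equal to `1#` by definition, so that `con 1ℤ` denotes
    -- `1#` itself and not `1# + 0#`.
    ⟦_⟧ : ℤ → Carrier
    ⟦ + n ⟧      = n × 1#
    ⟦ -[1+ n ] ⟧ = - (suc n × 1#)

    neg-homo : ∀ i → ⟦ ℤ.- i ⟧ ≈ - ⟦ i ⟧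
    neg-homo (+ zero)  = sym -0#≈0#
    neg-homo (+ suc n) = refl
    neg-homo -[1+ n ]  = sym (-‿involutive _)

    ⊖-homo : ∀ m n → ⟦ m ⊖ n ⟧ ≈ m × 1# - n × 1#
    ⊖-homo m zero = sym (trans (+-congˡ -0#≈0#) (+-identityʳ _))
    ⊖-homo zero (suc n) = sym (+-identityˡ _)
    ⊖-homo (suc m) (suc n) = begin
      ⟦ suc m ⊖ suc n ⟧                    ≡⟨ cong ⟦_⟧ (ℤ.[1+m]⊖[1+n]≡m⊖n m n) ⟩
      ⟦ m ⊖ n ⟧                            ≈⟨ ⊖-homo m n ⟩
      a - b                                ≈⟨ +-congˡ (+-identityˡ (- b)) ⟨
      a + (0# - b)                         ≈⟨ +-congˡ (+-congʳ (-‿inverseʳ 1#)) ⟨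
      a + (1# - 1# - b)                    ≈⟨ +-congˡ (+-assoc 1# (- 1#) (- b)) ⟩
      a + (1# + (- 1# - b))                ≈⟨ +-congˡ (+-congˡ (⁻¹-∙-comm 1# b)) ⟩
      a + (1# - (1# + b))                  ≈⟨ +-assoc a 1# _ ⟨
      a + 1# - (1# + b)                    ≈⟨ +-congʳ (+-comm a 1#) ⟩
      1# + a - (1# + b)                    ≈⟨ +-cong (1+× m 1#) (-‿cong (1+× n 1#)) ⟨
      suc m × 1# - suc n × 1#              ∎
      where
      a = m × 1#
      b = n × 1#

    +-homo : ∀ i j → ⟦ i ℤ.+ j ⟧ ≈ ⟦ i ⟧ + ⟦ j ⟧
    +-homo (+ m) (+ n) = ×-homo-+ 1# m n
    +-homo (+ m) -[1+ n ] = ⊖-homo m (suc n)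
    +-homo -[1+ m ] (+ n) = trans (⊖-homo n (suc m)) (+-comm _ _)
    +-homo -[1+ m ] -[1+ n ] = begin
      - (suc (suc (m ℕ.+ n)) × 1#)         ≡⟨ cong (λ k → - (suc k × 1#)) (ℕ.+-suc m n) ⟨
      - ((suc m ℕ.+ suc n) × 1#)           ≈⟨ -‿cong (×-homo-+ 1# (suc m) (suc n)) ⟩
      - (suc m × 1# + suc n × 1#)          ≈⟨ ⁻¹-∙-comm _ _ ⟨
      - (suc m × 1#) - (suc n × 1#)        ∎

    +*-homo : ∀ m j → ⟦ + m ℤ.* j ⟧ ≈ m × 1# * ⟦ j ⟧
    +*-homo m (+ n) = begin
      ⟦ + m ℤ.* + n ⟧                      ≡⟨ cong ⟦_⟧ (ℤ.pos-* m n) ⟨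
      (m ℕ.* n) × 1#                       ≈⟨ ×1-homo-* m n ⟩
      m × 1# * n × 1#                      ∎
    +*-homo m -[1+ n ] = begin
      ⟦ + m ℤ.* -[1+ n ] ⟧                 ≡⟨ cong ⟦_⟧ (ℤ.neg-distribʳ-* (+ m) (+ suc n)) ⟨
      ⟦ ℤ.- (+ m ℤ.* + suc n) ⟧            ≈⟨ neg-homo (+ m ℤ.* + suc n) ⟩
      - ⟦ + m ℤ.* + suc n ⟧                ≈⟨ -‿cong (+*-homo m (+ suc n)) ⟩
      - (m × 1# * suc n × 1#)              ≈⟨ -‿distribʳ-* _ _ ⟩
      m × 1# * - (suc n × 1#)              ∎

    *-homo : ∀ i j → ⟦ i ℤ.* j ⟧ ≈ ⟦ i ⟧ * ⟦ j ⟧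
    *-homo (+ m) j = +*-homo m j
    *-homo -[1+ m ] j = begin
      ⟦ -[1+ m ] ℤ.* j ⟧                   ≡⟨ cong ⟦_⟧ (ℤ.neg-distribˡ-* (+ suc m) j) ⟨
      ⟦ ℤ.- (+ suc m ℤ.* j) ⟧              ≈⟨ neg-homo (+ suc m ℤ.* j) ⟩
      - ⟦ + suc m ℤ.* j ⟧                  ≈⟨ -‿cong (+*-homo (suc m) j) ⟩
      - (suc m × 1# * ⟦ j ⟧)               ≈⟨ -‿distribˡ-* _ _ ⟩
      - (suc m × 1#) * ⟦ j ⟧               ∎

    morphism : ℤ.+-*-rawRing -Raw-AlmostCommutative⟶ fromCommutativeRing R
    morphism = record
      { ⟦_⟧ = ⟦_⟧
      ; +-homo = +-homo
      ; *-homo = *-homo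
      ; -‿homo = neg-homo
      ; 0-homo = refl
      ; 1-homo = refl
      }

    _≟_ : WeaklyDecidable (Induced-equivalence morphism)
    i ≟ j = Maybe.map (reflexive ∘ cong ⟦_⟧) (dec⇒maybe (i ℤ.≟ j))

  open RingSolver ℤ.+-*-rawRing (fromCommutativeRing R) morphism _≟_ public
    using (Polynomial; con; solve; _:+_; _:*_; _:^_; :-_; _:-_; _:=_)

  -- Repeats the recursion of the unoptimised multiples, so that its value agrees with `ι n` by
  -- definition; `con (+ n)` would evaluate to a different term.
  :ι_ : ∀ {k} → ℕ → Polynomial k
  :ι zero  = con 0ℤ
  :ι suc n = con 1ℤ :+ :ι n
  infix 9 :ι_

  -- Computation modulo a hypothesis `d ≈ e`: the solver proves an identity with a correction term
  -- `a * (d - e)`, which is then removed. The multiplier `a` is the cofactor of the relation.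
  drop : ∀ {d e} a {b} → d ≈ e → b + a * (d - e) ≈ b
  drop {d} {e} a {b} d≈e = begin
    b + a * (d - e)      ≈⟨ +-congˡ (*-congˡ (+-congʳ d≈e)) ⟩
    b + a * (e - e)      ≈⟨ +-congˡ (*-congˡ (-‿inverseʳ e)) ⟩
    b + a * 0#           ≈⟨ +-congˡ (zeroʳ a) ⟩
    b + 0#               ≈⟨ +-identityʳ b ⟩
    b                    ∎

-- Finite differences of falling factorials, reciprocals and harmonic sums.

module Differences {c ℓ} (R : CommutativeRing c ℓ) where

  open CommutativeRing R
  open IntegerSolver R
  open Mult semiring using (_×_; ×1-homo-*)
  open Exp semiring using (_^_)
  open SetoidReasoning setoid

  ι : ℕ → Carrier
  ι n = n × 1#

  -- As in Expressions, but over a ring that need not be a field: it is also used over jets.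
  falling : Carrier → ℕ → Carrier
  falling u zero = 1#
  falling u (suc k) = falling u k * (u - ι k)

  -- δ n f = Σₖ (-1)ᵏ (n choose k) f k.
  δ : ℕ → (ℕ → Carrier) → Carrier
  δ zero f = f 0
  δ (suc n) f = δ n (λ k → f k - f (suc k))

  ∑ ∏ : ℕ → (ℕ → Carrier) → Carrier
  ∑ zero f = 0#
  ∑ (suc n) f = ∑ n f + f n
  ∏ zero f = 1#
  ∏ (suc n) f = ∏ n f * f n

  ∑-cong : ∀ {f g} n → (∀ k → k < n → f k ≈ g k) → ∑ n f ≈ ∑ n g
  ∑-cong zero f≈g = refl
  ∑-cong (suc n) f≈g = +-cong (∑-cong n λ k k<n → f≈g k (ℕ.m<n⇒m<1+n k<n)) (f≈g n ℕ.≤-refl)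

  ∑-head : ∀ n f → ∑ (suc n) f ≈ f 0 + ∑ n (f ∘ suc)
  ∑-head zero f = +-comm 0# (f 0)
  ∑-head (suc n) f = trans (+-congʳ (∑-head n f)) (+-assoc _ _ _)

  ∏-head : ∀ n f → ∏ (suc n) f ≈ f 0 * ∏ n (f ∘ suc)
  ∏-head zero f = *-comm 1# (f 0)
  ∏-head (suc n) f = trans (*-congʳ (∏-head n f)) (*-assoc _ _ _)

  ι-* : ∀ m n → ι (m ℕ.* n) ≈ ι m * ι n
  ι-* = ×1-homo-*

  falling-cong : ∀ {u v} k → u ≈ v → falling u k ≈ falling v k
  falling-cong zero u≈v = refl
  falling-cong (suc k) u≈v = *-cong (falling-cong k u≈v) (+-congʳ u≈v)

  falling-suc : ∀ u k → falling (u + 1#) (suc k) ≈ (u + 1#) * falling u k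
  falling-suc u zero =
    solve 1 (λ u → con 1ℤ :* (u :+ con 1ℤ :- con 0ℤ) := (u :+ con 1ℤ) :* con 1ℤ) refl u
  falling-suc u (suc k) = begin
    falling (u + 1#) (suc k) * (u + 1# - ι (suc k))   ≈⟨ *-congʳ (falling-suc u k) ⟩
    (u + 1#) * falling u k * (u + 1# - ι (suc k))     ≈⟨
      solve 3 (λ u φ k → (u :+ con 1ℤ) :* φ :* (u :+ con 1ℤ :- (con 1ℤ :+ k))
        := (u :+ con 1ℤ) :* (φ :* (u :- k))) refl u (falling u k) (ι k) ⟩
    (u + 1#) * (falling u k * (u - ι k))              ∎

  falling-difference : ∀ u k → falling u (suc k) - falling (u + 1#) (suc k) ≈ - ι (suc k) * falling u k
  falling-difference u k = begin
    falling u k * (u - ι k) - falling (u + 1#) (suc k)  ≈⟨ +-congˡ (-‿cong (falling-suc u k)) ⟩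
    falling u k * (u - ι k) - (u + 1#) * falling u k    ≈⟨
      solve 3 (λ u φ k → φ :* (u :- k) :- (u :+ con 1ℤ) :* φ := (:- (con 1ℤ :+ k)) :* φ)
        refl u (falling u k) (ι k) ⟩
    - ι (suc k) * falling u k                           ∎

  +-suc : ∀ u k → u + ι (suc k) ≈ u + ι k + 1#
  +-suc u k = solve 2 (λ u k → u :+ (con 1ℤ :+ k) := u :+ k :+ con 1ℤ) refl u (ι k)

  falling-shift-difference : ∀ u k m →
    falling (u + ι k) (suc m) - falling (u + ι (suc k)) (suc m) ≈ - ι (suc m) * falling (u + ι k) m
  falling-shift-difference u k m =
    trans (+-congˡ (-‿cong (falling-cong (suc m) (+-suc u k)))) (falling-difference (u + ι k) m)

  falling-+n : ∀ u n → falling (u + ι n) n ≈ ∏ n (λ j → u + ι (suc j))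
  falling-+n u zero = refl
  falling-+n u (suc n) = begin
    falling (u + ι (suc n)) (suc n)                    ≈⟨ falling-cong (suc n) (+-suc u n) ⟩
    falling (u + ι n + 1#) (suc n)                     ≈⟨ falling-suc (u + ι n) n ⟩
    (u + ι n + 1#) * falling (u + ι n) n               ≈⟨ *-cong (sym (+-suc u n)) (falling-+n u n) ⟩
    (u + ι (suc n)) * ∏ n (λ j → u + ι (suc j))        ≈⟨ *-comm _ _ ⟩
    ∏ n (λ j → u + ι (suc j)) * (u + ι (suc n))        ∎

  ∑-minus : ∀ n f g → ∑ n (λ k → f k - g k) ≈ ∑ n f - ∑ n g
  ∑-minus zero f g = sym (-‿inverseʳ 0#)
  ∑-minus (suc n) f g = trans (+-congʳ (∑-minus n f g))
    (solve 4 (λ s t a b → s :- t :+ (a :- b) := s :+ a :- (t :+ b)) refl (∑ n f) (∑ n g) (f n) (g n))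

  ∏-inverse : ∀ n {f g} → (∀ k → k < n → f k * g k ≈ 1#) → ∏ n f * ∏ n g ≈ 1#
  ∏-inverse zero inv = *-identityˡ 1#
  ∏-inverse (suc n) {f} {g} inv = begin
    ∏ n f * f n * (∏ n g * g n)
      ≈⟨ interchange (∏ n f) (f n) (∏ n g) (g n) ⟩
    ∏ n f * ∏ n g * (f n * g n)
      ≈⟨ *-cong (∏-inverse n λ k k<n → inv k (ℕ.m<n⇒m<1+n k<n)) (inv n ℕ.≤-refl) ⟩
    1# * 1#
      ≈⟨ *-identityˡ 1# ⟩
    1# ∎
    where open CommutativeSemigroupProperties *-commutativeSemigroup using (interchange)

  falling-2+ : ∀ u m → falling u (2 ℕ.+ m) ≈ u * (u - 1#) * falling (u - ι 2) m
  falling-2+ u m = begin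
    falling u (2 ℕ.+ m)
      ≈⟨ falling-cong (2 ℕ.+ m) (-+1 u) ⟩
    falling (u - 1# + 1#) (2 ℕ.+ m)
      ≈⟨ falling-suc (u - 1#) (suc m) ⟩
    (u - 1# + 1#) * falling (u - 1#) (suc m)
      ≈⟨ *-cong (sym (-+1 u)) (falling-cong (suc m)
           (solve 1 (λ u → u :- con 1ℤ := u :- :ι 2 :+ con 1ℤ) refl u)) ⟩
    u * falling (u - ι 2 + 1#) (suc m)
      ≈⟨ *-congˡ (falling-suc (u - ι 2) m) ⟩
    u * ((u - ι 2 + 1#) * falling (u - ι 2) m)
      ≈⟨ solve 2 (λ u φ → u :* ((u :- :ι 2 :+ con 1ℤ) :* φ) := u :* (u :- con 1ℤ) :* φ)
         refl u (falling (u - ι 2) m) ⟩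
    u * (u - 1#) * falling (u - ι 2) m ∎
    where
    -+1 : ∀ u → u ≈ u - 1# + 1#
    -+1 = solve 1 (λ u → u := u :- con 1ℤ :+ con 1ℤ) refl

  -- Both sides are the falling factorial of u + k of length n + k.
  falling-exchange : ∀ u n k →
    falling (u + ι k) k * falling u n ≈ falling (u + ι k) n * falling (u - ι n + ι k) k
  falling-exchange u n zero = trans (*-comm _ _) (*-congʳ (falling-cong n (sym (+-identityʳ u))))
  falling-exchange u n (suc k) = begin
    falling (u + ι (suc k)) (suc k) * falling u n
      ≈⟨ *-congʳ (falling-cong (suc k) (+-suc u k)) ⟩
    falling (t + 1#) (suc k) * falling u n
      ≈⟨ *-congʳ (falling-suc t k) ⟩
    (t + 1#) * falling t k * falling u n
      ≈⟨ *-assoc _ _ _ ⟩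
    (t + 1#) * (falling t k * falling u n)
      ≈⟨ *-congˡ (falling-exchange u n k) ⟩
    (t + 1#) * (falling t n * falling r k)
      ≈⟨ *-assoc _ _ _ ⟨
    (t + 1#) * falling t n * falling r k
      ≈⟨ *-congʳ (falling-suc t n) ⟨
    falling (t + 1#) n * (t + 1# - ι n) * falling r k
      ≈⟨ *-assoc _ _ _ ⟩
    falling (t + 1#) n * ((t + 1# - ι n) * falling r k)
      ≈⟨ *-cong (falling-cong n (sym (+-suc u k))) (*-congʳ
           (solve 3 (λ u n k → u :+ k :+ con 1ℤ :- n := u :- n :+ k :+ con 1ℤ) refl u (ι n) (ι k))) ⟩
    falling (u + ι (suc k)) n * ((r + 1#) * falling r k)
      ≈⟨ *-congˡ (falling-suc r k) ⟨
    falling (u + ι (suc k)) n * falling (r + 1#) (suc k)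
      ≈⟨ *-congˡ (falling-cong (suc k) (+-suc (u - ι n) k)) ⟨
    falling (u + ι (suc k)) n * falling (u - ι n + ι (suc k)) (suc k) ∎
    where
    t = u + ι k
    r = u - ι n + ι k

  falling-0 : ∀ k → falling 0# (suc k) ≈ 0#
  falling-0 zero = solve 0 (con 1ℤ :* (con 0ℤ :- con 0ℤ) := con 0ℤ) refl
  falling-0 (suc k) = trans (*-congʳ (falling-0 k)) (zeroˡ _)

  δ-cong : ∀ {f g} n → (∀ k → k ≤ n → f k ≈ g k) → δ n f ≈ δ n g
  δ-cong zero f≈g = f≈g 0 z≤n
  δ-cong (suc n) f≈g = δ-cong n λ k k≤n →
    +-cong (f≈g k (ℕ.m≤n⇒m≤1+n k≤n)) (-‿cong (f≈g (suc k) (s≤s k≤n)))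

  δ-suc : ∀ n f → δ (suc n) f ≈ δ n f - δ n (f ∘ suc)
  δ-suc zero f = refl
  δ-suc (suc n) f = δ-suc n (λ k → f k - f (suc k))

  δ-linear : ∀ n a b f g → δ n (λ k → a * f k + b * g k) ≈ a * δ n f + b * δ n g
  δ-linear zero a b f g = refl
  δ-linear (suc n) a b f g = trans
    (δ-cong n λ k _ → solve 6
      (λ a b f f′ g g′ → a :* f :+ b :* g :- (a :* f′ :+ b :* g′) := a :* (f :- f′) :+ b :* (g :- g′))
      refl a b (f k) (f (suc k)) (g k) (g (suc k)))
    (δ-linear n a b (λ k → f k - f (suc k)) (λ k → g k - g (suc k)))

  δ-scale : ∀ n a f → δ n (λ k → a * f k) ≈ a * δ n f
  δ-scale zero a f = refl
  δ-scale (suc n) a f = trans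
    (δ-cong n λ k _ → solve 3 (λ a f f′ → a :* f :- a :* f′ := a :* (f :- f′))
      refl a (f k) (f (suc k)))
    (δ-scale n a (λ k → f k - f (suc k)))

  -- Each difference shortens the falling factorial by one factor, and a constant is annihilated by
  -- the next one.
  δ-falling : ∀ {m n} u → m < n → δ n (λ k → falling (u + ι k) m) ≈ 0#
  δ-falling {zero} {suc n} u _ = begin
    δ n (λ _ → 1# - 1#)        ≈⟨ δ-cong n (λ _ _ → trans (-‿inverseʳ 1#) (sym (zeroˡ 0#))) ⟩
    δ n (λ _ → 0# * 0#)        ≈⟨ δ-scale n 0# (λ _ → 0#) ⟩
    0# * δ n (λ _ → 0#)        ≈⟨ zeroˡ _ ⟩
    0#                         ∎
  δ-falling {suc m} {suc n} u (s≤s m<n) = begin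
    δ n (λ k → falling (u + ι k) (suc m) - falling (u + ι (suc k)) (suc m))
      ≈⟨ δ-cong n (λ k _ → falling-shift-difference u k m) ⟩
    δ n (λ k → - ι (suc m) * falling (u + ι k) m)
      ≈⟨ δ-scale n (- ι (suc m)) (λ k → falling (u + ι k) m) ⟩
    - ι (suc m) * δ n (λ k → falling (u + ι k) m)
      ≈⟨ *-congˡ (δ-falling u m<n) ⟩
    - ι (suc m) * 0#
      ≈⟨ zeroʳ _ ⟩
    0# ∎

  -- In the induction the two shifted products share all factors except w₀ and w′, the inverses of u
  -- and u + n + 1, and w₀ - w′ = (n + 1) w₀ w′.
  δ-reciprocal : ∀ n u w → (∀ k → k ≤ n → w k * (u + ι k) ≈ 1#) → δ n w ≈ ι (n !) * ∏ (suc n) w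
  δ-reciprocal zero u w _ =
    solve 1 (λ w → w := (con 1ℤ :+ con 0ℤ) :* (con 1ℤ :* w)) refl (w 0)
  δ-reciprocal (suc n) u w inv = begin
    δ (suc n) w
      ≈⟨ δ-suc n w ⟩
    δ n w - δ n (w ∘ suc)
      ≈⟨ +-cong (δ-reciprocal n u w λ k k≤n → inv k (ℕ.m≤n⇒m≤1+n k≤n))
                (-‿cong (δ-reciprocal n (u + 1#) (w ∘ suc) λ k k≤n →
                  trans (*-congˡ (+-assoc u 1# (ι k))) (inv (suc k) (s≤s k≤n)))) ⟩
    ι (n !) * ∏ (suc n) w - ι (n !) * (p * w′)
      ≈⟨ +-congʳ (*-congˡ (∏-head n w)) ⟩
    ι (n !) * (w₀ * p) - ι (n !) * (p * w′)
      ≈⟨ solve 6 (λ φ w₀ w′ p u n →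
           φ :* (w₀ :* p) :- φ :* (p :* w′) :=
           (con 1ℤ :+ n) :* φ :* (w₀ :* p :* w′)
             :+ φ :* p :* w′ :* (w₀ :* (u :+ con 0ℤ) :- con 1ℤ)
             :+ (:- (φ :* p :* w₀)) :* (w′ :* (u :+ (con 1ℤ :+ n)) :- con 1ℤ))
         refl (ι (n !)) w₀ w′ p u (ι n) ⟩
    ι (suc n) * ι (n !) * (w₀ * p * w′)
      + ι (n !) * p * w′ * (w₀ * (u + 0#) - 1#)
      + - (ι (n !) * p * w₀) * (w′ * (u + ι (suc n)) - 1#)
      ≈⟨ drop _ (inv (suc n) ℕ.≤-refl) ⟩
    ι (suc n) * ι (n !) * (w₀ * p * w′) + ι (n !) * p * w′ * (w₀ * (u + 0#) - 1#)
      ≈⟨ drop _ (inv 0 z≤n) ⟩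
    ι (suc n) * ι (n !) * (w₀ * p * w′)
      ≈⟨ *-cong (ι-* (suc n) (n !)) (*-congʳ (∏-head n w)) ⟨
    ι (suc n !) * ∏ (suc (suc n)) w ∎
    where
    w₀ = w 0
    w′ = w (suc n)
    p = ∏ n (w ∘ suc)

  -- Only the remainder of the falling factorial modulo u + k contributes, by δ-falling.
  δ-falling-reciprocal : ∀ {m n} u v w → m ≤ n → (∀ k → k ≤ n → w k * (u + ι k) ≈ 1#) →
    δ n (λ k → falling (v + ι k) m * w k) ≈ falling (v - u) m * (ι (n !) * ∏ (suc n) w)
  δ-falling-reciprocal {zero} {n} u v w _ inv = begin
    δ n (λ k → 1# * w k)                ≈⟨ δ-scale n 1# w ⟩
    1# * δ n w                          ≈⟨ *-congˡ (δ-reciprocal n u w inv) ⟩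
    1# * (ι (n !) * ∏ (suc n) w)        ∎
  δ-falling-reciprocal {suc m} {n} u v w m<n inv = begin
    δ n (λ k → falling (v + ι k) m * (v + ι k - ι m) * w k)
      -- The factor v + k - m is split as (v - u - m) + (u + k); the second part cancels against
      -- `w k`.
      ≈⟨ δ-cong n (λ k k≤n → trans
           (solve 6 (λ φ v u k m w →
              φ :* (v :+ k :- m) :* w :=
              con 1ℤ :* φ :+ (v :- u :- m) :* (φ :* w) :+ φ :* (w :* (u :+ k) :- con 1ℤ))
            refl (falling (v + ι k) m) v u (ι k) (ι m) (w k))
           (drop _ (inv k k≤n))) ⟩
    δ n (λ k → 1# * falling (v + ι k) m + (v - u - ι m) * (falling (v + ι k) m * w k))
      ≈⟨ δ-linear n 1# (v - u - ι m) (λ k → falling (v + ι k) m) (λ k → falling (v + ι k) m * w k) ⟩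
    1# * δ n (λ k → falling (v + ι k) m) + (v - u - ι m) * δ n (λ k → falling (v + ι k) m * w k)
      ≈⟨ +-cong (*-congˡ (δ-falling v m<n))
                (*-congˡ (δ-falling-reciprocal u v w (ℕ.<⇒≤ m<n) inv)) ⟩
    1# * 0# + (v - u - ι m) * (falling (v - u) m * (ι (n !) * ∏ (suc n) w))
      ≈⟨ solve 3 (λ a b c → con 1ℤ :* con 0ℤ :+ a :* (b :* c) := b :* a :* c)
         refl (v - u - ι m) (falling (v - u) m) (ι (n !) * ∏ (suc n) w) ⟩
    falling (v - u) m * (v - u - ι m) * (ι (n !) * ∏ (suc n) w) ∎

  -- Up to sign the falling factorial is (v + 2) ⋯ (v + m + 1). The extra factor v + 1 completes it
  -- to the product that occurs in the numerator of P.
  falling-negative : ∀ v m →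
    falling (- (v + ι 2)) m * (v + ι 1) ≈ (- 1#) ^ m * ∏ (suc m) (λ j → v + ι (suc j))
  falling-negative v zero =
    solve 1 (λ v → con 1ℤ :* (v :+ :ι 1) := con 1ℤ :* (con 1ℤ :* (v :+ :ι 1))) refl v
  falling-negative v (suc m) = begin
    φ * (- (v + ι 2) - ι m) * (v + ι 1)
      ≈⟨ solve 4 (λ φ v m z → φ :* (:- (v :+ :ι 2) :- m) :* z :=
           (:- (v :+ (con 1ℤ :+ (con 1ℤ :+ m)))) :* (φ :* z)) refl φ v (ι m) (v + ι 1) ⟩
    - (v + ι (2 ℕ.+ m)) * (φ * (v + ι 1))
      ≈⟨ *-congˡ (falling-negative v m) ⟩
    - (v + ι (2 ℕ.+ m)) * (s * p)
      ≈⟨ solve 3 (λ a s p → (:- a) :* (s :* p) := (:- con 1ℤ) :* s :* (p :* a))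
         refl (v + ι (2 ℕ.+ m)) s p ⟩
    - 1# * s * (p * (v + ι (2 ℕ.+ m))) ∎
    where
    φ = falling (- (v + ι 2)) m
    s = (- 1#) ^ m
    p = ∏ (suc m) (λ j → v + ι (suc j))

  module _ (x y q : Carrier) (q-inv : q * (x - y + ι 1) ≈ 1#) (w : ℕ → Carrier) where

    private
      v : ℕ → Carrier
      v j = x - y + ι (suc j)

    -- Here `q` stands for 1 / (1 + x - y), and the product of the `v j` and `w j` for P. The factor
    -- y (y - 1) stays on the left, as nothing makes it invertible in the ring.
    δ-falling-harmonic : ∀ m → (∀ j → j < 2 ℕ.+ m → w j * (x + ι (suc j)) ≈ 1#) →
      y * (y - 1#) * δ (2 ℕ.+ m) (λ k → falling (y - ι 2 + ι k) m * ∑ k w) ≈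
      (- 1#) ^ m * ι (m !) * ((1# + ι (2 ℕ.+ m) * y * q) * (∏ (2 ℕ.+ m) v * ∏ (2 ℕ.+ m) w) - 1#)
    δ-falling-harmonic zero inv = begin
      y * (y - 1#) * δ 2 (λ k → 1# * ∑ k w)
        -- Modulo the inverse relations both sides equal - y (y - 1) w₀ w₁; the last three summands
        -- are the multiples of these relations that make up the difference.
        ≈⟨ solve 5 (λ x y q w₀ w₁ →
             let v₀ = x :- y :+ :ι 1
                 v₁ = x :- y :+ :ι 2
                 h₀ = con 1ℤ :* con 0ℤ
                 h₁ = con 1ℤ :* (con 0ℤ :+ w₀)
                 h₂ = con 1ℤ :* (con 0ℤ :+ w₀ :+ w₁)
                 z = y :* (y :- con 1ℤ)
             in
             z :* (h₀ :- h₁ :- (h₁ :- h₂)) :=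
             con 1ℤ :* :ι 1 :* ((con 1ℤ :+ :ι 2 :* y :* q)
                 :* (con 1ℤ :* v₀ :* v₁ :* (con 1ℤ :* w₀ :* w₁)) :- con 1ℤ)
               :+ (:- (w₁ :* (z :+ x :+ :ι 2))) :* (w₀ :* (x :+ :ι 1) :- con 1ℤ)
               :+ (z :* w₀ :- con 1ℤ) :* (w₁ :* (x :+ :ι 2) :- con 1ℤ)
               :+ (:- (:ι 2 :* y :* v₁ :* w₀ :* w₁)) :* (q :* v₀ :- con 1ℤ))
           refl x y q (w 0) (w 1) ⟩
      _ ≈⟨ drop _ q-inv ⟩
      _ ≈⟨ drop _ (inv 1 ℕ.≤-refl) ⟩
      _ ≈⟨ drop _ (inv 0 (s≤s z≤n)) ⟩
      (- 1#) ^ 0 * ι (0 !) * ((1# + ι 2 * y * q) * (∏ 2 v * ∏ 2 w) - 1#) ∎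
    δ-falling-harmonic (suc m) inv = begin
      z * δ n (λ k → f (suc m) k - f (suc m) (suc k))
        ≈⟨ *-congˡ (δ-cong n λ k _ → difference k) ⟩
      z * δ n (λ k → - ι (suc m) * f m k + - 1# * g k)
        ≈⟨ *-congˡ (δ-linear n (- ι (suc m)) (- 1#) (f m) g) ⟩
      z * (- ι (suc m) * δ n (f m) + - 1# * δ n g)
        ≈⟨ solve 4 (λ z a b c → z :* ((:- a) :* b :+ (:- con 1ℤ) :* c) := (:- a) :* (z :* b) :- z :* c)
           refl z (ι (suc m)) (δ n (f m)) (δ n g) ⟩
      - ι (suc m) * (z * δ n (f m)) - z * δ n g
        ≈⟨ +-cong (*-congˡ (δ-falling-harmonic m λ j j<n → inv j (ℕ.m<n⇒m<1+n j<n)))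
                  (-‿cong (*-congˡ δ-g)) ⟩
      - ι (suc m) * (s * ι (m !) * ((1# + ι n * y * q) * (pv * pw) - 1#))
        - z * (q * (- 1# * s * pv) * (ι n * (ι (suc m) * ι (m !)) * (pw * w n)))
        -- With P = `pv * pw`, passing from n to n + 1 changes (1 + n y q) P by - n y (y - 1) q (w
        -- n) P, which is exactly what `δ n g` contributes.
        ≈⟨ solve 10 (λ s φ μ x y q pv pw w ν →
             let n = con 1ℤ :+ ν
                 n′ = con 1ℤ :+ n
                 m′ = con 1ℤ :+ μ
             in
             (:- m′) :* (s :* φ :* ((con 1ℤ :+ n :* y :* q) :* (pv :* pw) :- con 1ℤ))
               :- y :* (y :- con 1ℤ) :* (q :* ((:- con 1ℤ) :* s :* pv) :* (n :* (m′ :* φ) :* (pw :* w))) :=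
             (:- con 1ℤ) :* s :* (m′ :* φ) :* ((con 1ℤ :+ n′ :* y :* q)
                 :* (pv :* (x :- y :+ n′) :* (pw :* w)) :- con 1ℤ)
               :+ s :* m′ :* φ :* (con 1ℤ :+ n :* y :* q) :* pv :* pw :* (w :* (x :+ n′) :- con 1ℤ)
               :+ s :* m′ :* φ :* pv :* pw :* w :* y :* (q :* (x :- y :+ :ι 1) :- con 1ℤ))
           refl s (ι (m !)) (ι m) x y q pv pw (w n) (ι (suc m)) ⟩
      _ ≈⟨ drop _ q-inv ⟩
      _ ≈⟨ drop _ (inv n ℕ.≤-refl) ⟩
      - 1# * s * (ι (suc m) * ι (m !)) * ((1# + ι (suc n) * y * q) * (∏ (suc n) v * ∏ (suc n) w) - 1#)
        ≈⟨ *-congʳ (*-congˡ (ι-* (suc m) (m !))) ⟨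
      - 1# * s * ι (suc m !) * ((1# + ι (suc n) * y * q) * (∏ (suc n) v * ∏ (suc n) w) - 1#) ∎
      where
      n = 2 ℕ.+ m
      z = y * (y - 1#)
      s = (- 1#) ^ m
      pv = ∏ n v
      pw = ∏ n w
      f : ℕ → ℕ → Carrier
      f m k = falling (y - ι 2 + ι k) m * ∑ k w
      g : ℕ → Carrier
      g k = falling (y - ι 2 + 1# + ι k) (suc m) * w k

      -- Product rule for differences. The second term takes the falling factorial at k + 1, whence
      -- the `1#` in `g`.
      difference : ∀ k → f (suc m) k - f (suc m) (suc k) ≈ - ι (suc m) * f m k + - 1# * g k
      difference k = begin
        a * ∑ k w - b * (∑ k w + w k)
          ≈⟨ solve 4 (λ a b h w → a :* h :- b :* (h :+ w) := (a :- b) :* h :+ (:- con 1ℤ) :* (b :* w))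
             refl a b (∑ k w) (w k) ⟩
        (a - b) * ∑ k w + - 1# * (b * w k)
          ≈⟨ +-cong (*-congʳ (falling-shift-difference (y - ι 2) k m))
                    (*-congˡ (*-congʳ (falling-cong (suc m) (sym (+-assoc (y - ι 2) 1# (ι k)))))) ⟩
        - ι (suc m) * falling (y - ι 2 + ι k) m * ∑ k w + - 1# * g k
          ≈⟨ +-congʳ (*-assoc _ _ _) ⟩
        - ι (suc m) * f m k + - 1# * g k ∎
        where
        a = falling (y - ι 2 + ι k) (suc m)
        b = falling (y - ι 2 + ι (suc k)) (suc m)

      falling-v : falling (y - ι 2 + 1# - (x + 1#)) (suc m) ≈ q * (- 1# * s * pv)
      falling-v = begin
        falling (y - ι 2 + 1# - (x + 1#)) (suc m)
          ≈⟨ falling-cong (suc m) (solve 2 (λ x y →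
               y :- :ι 2 :+ con 1ℤ :- (x :+ con 1ℤ) := :- (x :- y :+ :ι 2)) refl x y) ⟩
        φ
          ≈⟨ *-identityʳ φ ⟨
        φ * 1#
          ≈⟨ *-congˡ q-inv ⟨
        φ * (q * (x - y + ι 1))
          ≈⟨ solve 3 (λ φ q v → φ :* (q :* v) := q :* (φ :* v)) refl φ q (x - y + ι 1) ⟩
        q * (φ * (x - y + ι 1))
          ≈⟨ *-congˡ (falling-negative (x - y) (suc m)) ⟩
        q * (- 1# * s * pv) ∎
        where
        φ = falling (- (x - y + ι 2)) (suc m)

      δ-g : δ n g ≈ q * (- 1# * s * pv) * (ι n * (ι (suc m) * ι (m !)) * (pw * w n))
      δ-g = begin
        δ n g
          ≈⟨ δ-falling-reciprocal (x + 1#) (y - ι 2 + 1#) w (ℕ.n≤1+n (suc m)) (λ k k≤n →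
               trans (*-congˡ (+-assoc x 1# (ι k))) (inv k (s≤s k≤n))) ⟩
        falling (y - ι 2 + 1# - (x + 1#)) (suc m) * (ι (n !) * (pw * w n))
          ≈⟨ *-cong falling-v (*-congʳ
               (trans (ι-* n (suc m !)) (*-congˡ (ι-* (suc m) (m !))))) ⟩
        q * (- 1# * s * pv) * (ι n * (ι (suc m) * ι (m !)) * (pw * w n)) ∎

-- Truncated Taylor arithmetic.

-- Polynomials in ε modulo ε⁴.
module Jets {c ℓ} (R : CommutativeRing c ℓ) where

  open CommutativeRing R
  open IntegerSolver R

  record Jet : Set c where
    constructor jet
    field c₀ c₁ c₂ c₃ : Carrier

  open Jet public

  record _≋_ (a b : Jet) : Set ℓ where
    constructor mk≋
    field
      ≈₀ : c₀ a ≈ c₀ b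
      ≈₁ : c₁ a ≈ c₁ b
      ≈₂ : c₂ a ≈ c₂ b
      ≈₃ : c₃ a ≈ c₃ b

  open _≋_ public

  infix 4 _≋_

  constant : Carrier → Jet
  constant u = jet u 0# 0# 0#

  private

    _⊕_ _⊗_ : Jet → Jet → Jet
    jet a b c d ⊕ jet a′ b′ c′ d′ = jet (a + a′) (b + b′) (c + c′) (d + d′)
    jet a b c d ⊗ jet a′ b′ c′ d′ = jet
      (a * a′)
      (a * b′ + b * a′)
      (a * c′ + b * b′ + c * a′)
      (a * d′ + b * c′ + c * b′ + d * a′)

    ≋-isEquivalence : IsEquivalence _≋_
    ≋-isEquivalence = record
      { refl = mk≋ refl refl refl refl
      ; sym = λ (mk≋ p q r s) → mk≋ (sym p) (sym q) (sym r) (sym s)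
      ; trans = λ (mk≋ p q r s) (mk≋ p′ q′ r′ s′) →
          mk≋ (trans p p′) (trans q q′) (trans r r′) (trans s s′)
      }

    jetSetoid : Setoid c ℓ
    jetSetoid = record { isEquivalence = ≋-isEquivalence }

    open Consequences jetSetoid using (comm∧idˡ⇒id; comm∧distrˡ⇒distr)

    ⊕-cong : Congruent₂ _≋_ _⊕_
    ⊕-cong (mk≋ p q r s) (mk≋ p′ q′ r′ s′) =
      mk≋ (+-cong p p′) (+-cong q q′) (+-cong r r′) (+-cong s s′)

    ⊗-cong : Congruent₂ _≋_ _⊗_
    ⊗-cong (mk≋ p q r s) (mk≋ p′ q′ r′ s′) = mk≋
      (*-cong p p′)
      (+-cong (*-cong p q′) (*-cong q p′))
      (+-cong (+-cong (*-cong p r′) (*-cong q q′)) (*-cong r p′))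
      (+-cong (+-cong (+-cong (*-cong p s′) (*-cong q r′)) (*-cong r q′)) (*-cong s p′))

    ⊗-comm : Commutative _≋_ _⊗_
    ⊗-comm (jet a b c d) (jet a′ b′ c′ d′) = mk≋
      (*-comm a a′)
      (solve 4 (λ a b a′ b′ → a :* b′ :+ b :* a′ := a′ :* b :+ b′ :* a) refl a b a′ b′)
      (solve 6 (λ a b c a′ b′ c′ →
         a :* c′ :+ b :* b′ :+ c :* a′ := a′ :* c :+ b′ :* b :+ c′ :* a) refl a b c a′ b′ c′)
      (solve 8 (λ a b c d a′ b′ c′ d′ →
         a :* d′ :+ b :* c′ :+ c :* b′ :+ d :* a′ :=
         a′ :* d :+ b′ :* c :+ c′ :* b :+ d′ :* a) refl a b c d a′ b′ c′ d′)

    ⊗-assoc : Associative _≋_ _⊗_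
    ⊗-assoc (jet a b c d) (jet a′ b′ c′ d′) (jet a″ b″ c″ d″) = mk≋
      (*-assoc a a′ a″)
      (solve 6 (λ a b a′ b′ a″ b″ →
         a :* a′ :* b″ :+ (a :* b′ :+ b :* a′) :* a″ :=
         a :* (a′ :* b″ :+ b′ :* a″) :+ b :* (a′ :* a″)) refl a b a′ b′ a″ b″)
      (solve 9 (λ a b c a′ b′ c′ a″ b″ c″ →
         a :* a′ :* c″ :+ (a :* b′ :+ b :* a′) :* b″
           :+ (a :* c′ :+ b :* b′ :+ c :* a′) :* a″ :=
         a :* (a′ :* c″ :+ b′ :* b″ :+ c′ :* a″) :+ b :* (a′ :* b″ :+ b′ :* a″)
           :+ c :* (a′ :* a″)) refl a b c a′ b′ c′ a″ b″ c″)
      (solve 12 (λ a b c d a′ b′ c′ d′ a″ b″ c″ d″ →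
         a :* a′ :* d″ :+ (a :* b′ :+ b :* a′) :* c″
           :+ (a :* c′ :+ b :* b′ :+ c :* a′) :* b″
           :+ (a :* d′ :+ b :* c′ :+ c :* b′ :+ d :* a′) :* a″ :=
         a :* (a′ :* d″ :+ b′ :* c″ :+ c′ :* b″ :+ d′ :* a″)
           :+ b :* (a′ :* c″ :+ b′ :* b″ :+ c′ :* a″) :+ c :* (a′ :* b″ :+ b′ :* a″)
           :+ d :* (a′ :* a″)) refl a b c d a′ b′ c′ d′ a″ b″ c″ d″)

    ⊗-identityˡ : LeftIdentity _≋_ (constant 1#) _⊗_
    ⊗-identityˡ (jet a b c d) = mk≋
      (*-identityˡ a)
      (solve 2 (λ a b → con 1ℤ :* b :+ con 0ℤ :* a := b) refl a b)
      (solve 3 (λ a b c → con 1ℤ :* c :+ con 0ℤ :* b :+ con 0ℤ :* a := c) refl a b c)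
      (solve 4 (λ a b c d → con 1ℤ :* d :+ con 0ℤ :* c :+ con 0ℤ :* b :+ con 0ℤ :* a := d)
        refl a b c d)

    ⊗-distribˡ-⊕ : _DistributesOverˡ_ _≋_ _⊗_ _⊕_
    ⊗-distribˡ-⊕ (jet a b c d) (jet a′ b′ c′ d′) (jet a″ b″ c″ d″) = mk≋
      (distribˡ a a′ a″)
      (solve 6 (λ a b a′ b′ a″ b″ →
         a :* (b′ :+ b″) :+ b :* (a′ :+ a″) :=
         a :* b′ :+ b :* a′ :+ (a :* b″ :+ b :* a″)) refl a b a′ b′ a″ b″)
      (solve 9 (λ a b c a′ b′ c′ a″ b″ c″ →
         a :* (c′ :+ c″) :+ b :* (b′ :+ b″) :+ c :* (a′ :+ a″) :=
         a :* c′ :+ b :* b′ :+ c :* a′ :+ (a :* c″ :+ b :* b″ :+ c :* a″))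
         refl a b c a′ b′ c′ a″ b″ c″)
      (solve 12 (λ a b c d a′ b′ c′ d′ a″ b″ c″ d″ →
         a :* (d′ :+ d″) :+ b :* (c′ :+ c″) :+ c :* (b′ :+ b″) :+ d :* (a′ :+ a″) :=
         a :* d′ :+ b :* c′ :+ c :* b′ :+ d :* a′
           :+ (a :* d″ :+ b :* c″ :+ c :* b″ :+ d :* a″))
         refl a b c d a′ b′ c′ d′ a″ b″ c″ d″)

  jetRing : CommutativeRing c ℓ
  jetRing = record
    { Carrier = Jet
    ; _≈_ = _≋_
    ; _+_ = _⊕_
    ; _*_ = _⊗_
    ; -_ = λ (jet a b c d) → jet (- a) (- b) (- c) (- d)
    ; 0# = constant 0#
    ; 1# = constant 1#
    ; isCommutativeRing = record
      { isRing = record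
        { +-isAbelianGroup = record
          { isGroup = record
            { isMonoid = record
              { isSemigroup = record
                { isMagma = record { isEquivalence = ≋-isEquivalence ; ∙-cong = ⊕-cong }
                ; assoc = λ _ _ _ →
                    mk≋ (+-assoc _ _ _) (+-assoc _ _ _) (+-assoc _ _ _) (+-assoc _ _ _)
                }
              ; identity =
                  (λ _ → mk≋ (+-identityˡ _) (+-identityˡ _) (+-identityˡ _) (+-identityˡ _)) ,
                  (λ _ → mk≋ (+-identityʳ _) (+-identityʳ _) (+-identityʳ _) (+-identityʳ _))
              }
            ; inverse =
                (λ _ → mk≋ (-‿inverseˡ _) (-‿inverseˡ _) (-‿inverseˡ _) (-‿inverseˡ _)) ,
                (λ _ → mk≋ (-‿inverseʳ _) (-‿inverseʳ _) (-‿inverseʳ _) (-‿inverseʳ _))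
            ; ⁻¹-cong = λ (mk≋ p q r s) → mk≋ (-‿cong p) (-‿cong q) (-‿cong r) (-‿cong s)
            }
          ; comm = λ _ _ → mk≋ (+-comm _ _) (+-comm _ _) (+-comm _ _) (+-comm _ _)
          }
        ; *-cong = ⊗-cong
        ; *-assoc = ⊗-assoc
        ; *-identity = comm∧idˡ⇒id ⊗-comm ⊗-identityˡ
        ; distrib = comm∧distrˡ⇒distr ⊕-cong ⊗-comm ⊗-distribˡ-⊕
        }
      ; *-comm = ⊗-comm
      }
    }

-- The coefficient of ε³ in the order 1 identity at x + ε.

module ThirdCoefficient {c ℓ} (R : CommutativeRing c ℓ) where

  open CommutativeRing R
  open IntegerSolver R
  open Exp semiring using (_^_)
  open Jets R
  open Differences R
  open SetoidReasoning setoid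
  private
    module J = CommutativeRing jetRing
    module JD = Differences jetRing
    module JExp = Exp J.semiring
    module JReasoning = SetoidReasoning J.setoid

  constant-+ : ∀ u v → constant u J.+ constant v ≋ constant (u + v)
  constant-+ u v = mk≋ refl (+-identityˡ 0#) (+-identityˡ 0#) (+-identityˡ 0#)

  constant-neg : ∀ u → J.- constant u ≋ constant (- u)
  constant-neg u = mk≋ refl -0≈0 -0≈0 -0≈0
    where
    -0≈0 = solve 0 (:- con 0ℤ := con 0ℤ) refl

  constant-minus : ∀ u v → constant u J.- constant v ≋ constant (u - v)
  constant-minus u v = J.trans (J.+-congˡ (constant-neg v)) (constant-+ u (- v))

  constant-*ˡ : ∀ u a → constant u J.* a ≋ jet (u * c₀ a) (u * c₁ a) (u * c₂ a) (u * c₃ a)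
  constant-*ˡ u (jet a b c d) = mk≋ refl
    (solve 3 (λ u a b → u :* b :+ con 0ℤ :* a := u :* b) refl u a b)
    (solve 4 (λ u a b c → u :* c :+ con 0ℤ :* b :+ con 0ℤ :* a := u :* c) refl u a b c)
    (solve 5 (λ u a b c d → u :* d :+ con 0ℤ :* c :+ con 0ℤ :* b :+ con 0ℤ :* a := u :* d)
      refl u a b c d)

  constant-* : ∀ u v → constant u J.* constant v ≋ constant (u * v)
  constant-* u v = J.trans (constant-*ˡ u (constant v)) (mk≋ refl (zeroʳ u) (zeroʳ u) (zeroʳ u))

  constant-ι : ∀ n → JD.ι n ≋ constant (ι n)
  constant-ι zero = J.refl
  constant-ι (suc n) = J.trans (J.+-congˡ (constant-ι n)) (constant-+ 1# (ι n))

  constant-falling : ∀ u m → JD.falling (constant u) m ≋ constant (falling u m)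
  constant-falling u zero = J.refl
  constant-falling u (suc m) = J.trans
    (J.*-cong (constant-falling u m)
      (J.trans (J.+-congˡ (J.-‿cong (constant-ι m))) (constant-minus u (ι m))))
    (constant-* (falling u m) (u - ι m))

  constant-sign : ∀ m → (J.- J.1#) JExp.^ m ≋ constant ((- 1#) ^ m)
  constant-sign zero = J.refl
  constant-sign (suc m) = J.trans (J.*-cong (constant-neg 1#) (constant-sign m))
    (constant-* (- 1#) ((- 1#) ^ m))

  -- Addition and negation of jets act coefficientwise, so every step of the recursion holds by
  -- definition.
  c₃-δ : ∀ n f → c₃ (JD.δ n f) ≡ δ n (c₃ ∘ f)
  c₃-δ zero f = ≡.refl
  c₃-δ (suc n) f = c₃-δ n (λ k → f k J.- f (suc k))

  c₃-∑ : ∀ n f → c₃ (JD.∑ n f) ≡ ∑ n (c₃ ∘ f)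
  c₃-∑ zero f = ≡.refl
  c₃-∑ (suc n) f = cong (_+ c₃ (f n)) (c₃-∑ n f)

  ∑-neg : ∀ n f → ∑ n (λ k → - f k) ≈ - 1# * ∑ n f
  ∑-neg zero f = solve 0 (con 0ℤ := (:- con 1ℤ) :* con 0ℤ) refl
  ∑-neg (suc n) f = trans (+-congʳ (∑-neg n f))
    (solve 2 (λ s a → (:- con 1ℤ) :* s :+ (:- a) := (:- con 1ℤ) :* (s :+ a)) refl (∑ n f) (f n))

  linear : Carrier → Jet
  linear u = jet u 1# 0# 0#

  -- The inverse of linear u⁻¹.
  reciprocal : Carrier → Jet
  reciprocal u = jet u (- u ^ 2) (u ^ 3) (- u ^ 4)

  linear-+ : ∀ u n → linear u J.+ JD.ι n ≋ linear (u + ι n)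
  linear-+ u n = J.trans (J.+-congˡ (constant-ι n))
    (mk≋ refl (+-identityʳ 1#) (+-identityʳ 0#) (+-identityʳ 0#))

  linear-minus : ∀ u v → linear u J.- constant v ≋ linear (u - v)
  linear-minus u v = J.trans (J.+-congˡ (constant-neg v))
    (mk≋ refl (+-identityʳ 1#) (+-identityʳ 0#) (+-identityʳ 0#))

  reciprocal-inverse : ∀ {u v} → u * v ≈ 1# → reciprocal u J.* linear v ≋ J.1#
  reciprocal-inverse {u} {v} inv = mk≋ inv
    (trans (solve 2 (λ u v →
      u :* con 1ℤ :+ (:- u :^ 2) :* v :=
      con 0ℤ :+ (:- u) :* (u :* v :- con 1ℤ)) refl u v) (drop _ inv))
    (trans (solve 2 (λ u v →
      u :* con 0ℤ :+ (:- u :^ 2) :* con 1ℤ :+ u :^ 3 :* v :=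
      con 0ℤ :+ u :^ 2 :* (u :* v :- con 1ℤ)) refl u v) (drop _ inv))
    (trans (solve 2 (λ u v →
      u :* con 0ℤ :+ (:- u :^ 2) :* con 0ℤ :+ u :^ 3 :* con 1ℤ :+ (:- u :^ 4) :* v :=
      con 0ℤ :+ (:- u :^ 3) :* (u :* v :- con 1ℤ)) refl u v) (drop _ inv))

  module _ (x y : Carrier) (w b : ℕ → Carrier) where

    private
      v : ℕ → Carrier
      v j = x - y + ι (suc j)

      V W : ℕ → Jet
      V j = linear x J.- constant y J.+ JD.ι (suc j)
      W j = reciprocal (w j)

      linear-V : ∀ j → V j ≋ linear (v j)
      linear-V j = J.trans (J.+-congʳ (linear-minus x y)) (linear-+ (x - y) (suc j))

    ratio : ℕ → Carrier
    ratio n = ∏ n v * ∏ n w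

    D : ℕ → ℕ → Carrier
    D ℓ n = ∑ n (λ j → w j ^ ℓ) - ∑ n (λ j → b j ^ ℓ)

    -- These are 6 h₃ and 2 h₂, the complete homogeneous symmetric polynomials written in power
    -- sums, with `D ℓ n` as the ℓ-th power sum. The generating function of h at - ε is the product
    -- of the (1 + b j ε) / (1 + w j ε), that is, P at x + ε divided by P.
    Dᴱ Dᶠ : ℕ → Carrier
    Dᴱ n = D 1 n ^ 3 + ι 2 * D 3 n + ι 3 * D 1 n * D 2 n
    Dᶠ n = D 1 n ^ 2 + D 2 n

    -- The Taylor coefficients f, f′, f″/2, f‴/6 at x of f = ∏ (x - y + j) / (x + j), whose
    -- logarithmic derivative is - D 1.
    record IsTaylor (n : ℕ) (P : Jet) : Set ℓ where
      field
        f : c₀ P ≈ ratio n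
        f′ : c₁ P ≈ - (ratio n * D 1 n)
        f″ : ι 2 * c₂ P ≈ ratio n * Dᶠ n
        f‴ : ι 6 * c₃ P ≈ - (ratio n * Dᴱ n)

    -- With v + ε = v (1 + b ε), one factor of P at x + ε is g (1 + b ε) / (1 + w ε) = g + g (b - w)
    -- ε / (1 + w ε), and the last fraction is a geometric series. All coefficients are thus
    -- multiples of g, which lets `ratio` be factored out in `taylor`.
    factor : ∀ j → b j * v j ≈ 1# → let g = v j * w j ; e = b j - w j in
      V j J.* W j ≋ jet g (g * e) (- (g * w j * e)) (g * w j ^ 2 * e)
    factor j inv = J.trans (J.*-congʳ (linear-V j)) (mk≋ refl
      (trans (solve 3 (λ v w b →
        v :* (:- w :^ 2) :+ con 1ℤ :* w :=
        v :* w :* (b :- w) :+ (:- w) :* (b :* v :- con 1ℤ)) refl (v j) (w j) (b j)) (drop _ inv))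
      (trans (solve 3 (λ v w b →
        v :* w :^ 3 :+ con 1ℤ :* (:- w :^ 2) :+ con 0ℤ :* w :=
        (:- (v :* w :* w :* (b :- w))) :+ w :^ 2 :* (b :* v :- con 1ℤ)) refl (v j) (w j) (b j))
        (drop _ inv))
      (trans (solve 3 (λ v w b →
        v :* (:- w :^ 4) :+ con 1ℤ :* w :^ 3 :+ con 0ℤ :* (:- w :^ 2) :+ con 0ℤ :* w :=
        v :* w :* w :^ 2 :* (b :- w) :+ (:- w :^ 3) :* (b :* v :- con 1ℤ)) refl (v j) (w j) (b j))
        (drop _ inv)))

    taylor : ∀ n → (∀ j → j < n → b j * v j ≈ 1#) → IsTaylor n (JD.∏ n V J.* JD.∏ n W)
    taylor zero _ = record
      { f = refl
      ; f′ = solve 0 (con 1ℤ :* con 0ℤ :+ con 0ℤ :* con 1ℤ :=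
          (:- (con 1ℤ :* con 1ℤ :* (con 0ℤ :- con 0ℤ)))) refl
      ; f″ = solve 0 (:ι 2 :* (con 1ℤ :* con 0ℤ :+ con 0ℤ :* con 0ℤ :+ con 0ℤ :* con 1ℤ) :=
          con 1ℤ :* con 1ℤ :* ((con 0ℤ :- con 0ℤ) :^ 2 :+ (con 0ℤ :- con 0ℤ))) refl
      ; f‴ = solve 0 (:ι 6 :* (con 1ℤ :* con 0ℤ :+ con 0ℤ :* con 0ℤ :+ con 0ℤ :* con 0ℤ :+ con 0ℤ :* con 1ℤ) :=
          (:- (con 1ℤ :* con 1ℤ :* ((con 0ℤ :- con 0ℤ) :^ 3 :+ :ι 2 :* (con 0ℤ :- con 0ℤ)
            :+ :ι 3 :* (con 0ℤ :- con 0ℤ) :* (con 0ℤ :- con 0ℤ))))) refl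
      }
    taylor (suc n) inv = record
      { f = trans (≈₀ P*VW) (trans (*-congʳ f) (solve 4 (λ pv pw a u →
          pv :* pw :* (a :* u) := pv :* a :* (pw :* u)) refl pv pw a u))
      ; f′ = begin
          c₁ P′
            ≈⟨ ≈₁ P*VW ⟩
          c₀ P * (g * e) + c₁ P * g
            ≈⟨ +-cong (*-congʳ f) (*-congʳ f′) ⟩
          ratio n * (g * e) + - (ratio n * D 1 n) * g
            ≈⟨ solve 7 (λ pv pw a u b S₁ T₁ →
                 pv :* pw :* (a :* u :* (b :- u)) :+ (:- (pv :* pw :* (S₁ :- T₁))) :* (a :* u) :=
                 (:- (pv :* a :* (pw :* u) :* (S₁ :+ u :^ 1 :- (T₁ :+ b :^ 1)))))
               refl pv pw a u (b n) (S 1) (T 1) ⟩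
          - (ratio (suc n) * D 1 (suc n)) ∎
      ; f″ = begin
          ι 2 * c₂ P′
            ≈⟨ *-congˡ (≈₂ P*VW) ⟩
          ι 2 * (c₀ P * - (g * u * e) + c₁ P * (g * e) + c₂ P * g)
            ≈⟨ solve 6 (λ P₀ P₁ P₂ g u e →
                 :ι 2 :* (P₀ :* (:- (g :* u :* e)) :+ P₁ :* (g :* e) :+ P₂ :* g) :=
                 P₀ :* (:- (:ι 2 :* g :* u :* e)) :+ P₁ :* (:ι 2 :* g :* e) :+ :ι 2 :* P₂ :* g)
               refl (c₀ P) (c₁ P) (c₂ P) g u e ⟩
          c₀ P * - (ι 2 * g * u * e) + c₁ P * (ι 2 * g * e) + ι 2 * c₂ P * g
            ≈⟨ +-cong (+-cong (*-congʳ f) (*-congʳ f′)) (*-congʳ f″) ⟩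
          ratio n * - (ι 2 * g * u * e) + - (ratio n * D 1 n) * (ι 2 * g * e) + ratio n * Dᶠ n * g
            ≈⟨ solve 9 (λ pv pw a u b S₁ T₁ S₂ T₂ →
                 let p = pv :* pw ; g = a :* u ; e = b :- u
                     D₁ = S₁ :- T₁ ; D₂ = S₂ :- T₂
                 in
                 p :* (:- (:ι 2 :* g :* u :* e)) :+ (:- (p :* D₁)) :* (:ι 2 :* g :* e)
                   :+ p :* (D₁ :^ 2 :+ D₂) :* g :=
                 pv :* a :* (pw :* u) :* ((S₁ :+ u :^ 1 :- (T₁ :+ b :^ 1)) :^ 2
                   :+ (S₂ :+ u :^ 2 :- (T₂ :+ b :^ 2))))
               refl pv pw a u (b n) (S 1) (T 1) (S 2) (T 2) ⟩
          ratio (suc n) * Dᶠ (suc n) ∎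
      ; f‴ = begin
          ι 6 * c₃ P′
            ≈⟨ *-congˡ (≈₃ P*VW) ⟩
          ι 6 * (c₀ P * (g * u ^ 2 * e) + c₁ P * - (g * u * e) + c₂ P * (g * e) + c₃ P * g)
            -- The induction hypotheses know `c₂ P` only multiplied by 2 and `c₃ P` only multiplied
            -- by 6, so the 6 before `c₂ P` is split as 2 · 3.
            ≈⟨ solve 7 (λ P₀ P₁ P₂ P₃ g u e →
                 :ι 6 :* (P₀ :* (g :* u :^ 2 :* e) :+ P₁ :* (:- (g :* u :* e)) :+ P₂ :* (g :* e)
                   :+ P₃ :* g) :=
                 P₀ :* (:ι 6 :* g :* u :^ 2 :* e) :+ P₁ :* (:- (:ι 6 :* g :* u :* e))
                   :+ :ι 2 :* P₂ :* (:ι 3 :* g :* e) :+ :ι 6 :* P₃ :* g)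
               refl (c₀ P) (c₁ P) (c₂ P) (c₃ P) g u e ⟩
          c₀ P * (ι 6 * g * u ^ 2 * e) + c₁ P * - (ι 6 * g * u * e)
            + ι 2 * c₂ P * (ι 3 * g * e) + ι 6 * c₃ P * g
            ≈⟨ +-cong (+-cong (+-cong (*-congʳ f) (*-congʳ f′)) (*-congʳ f″)) (*-congʳ f‴) ⟩
          ratio n * (ι 6 * g * u ^ 2 * e) + - (ratio n * D 1 n) * - (ι 6 * g * u * e)
            + ratio n * Dᶠ n * (ι 3 * g * e) + - (ratio n * Dᴱ n) * g
            ≈⟨ solve 11 (λ pv pw a u b S₁ T₁ S₂ T₂ S₃ T₃ →
                 let p = pv :* pw ; g = a :* u ; e = b :- u
                     D₁ = S₁ :- T₁ ; D₂ = S₂ :- T₂ ; D₃ = S₃ :- T₃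
                     D₁′ = S₁ :+ u :^ 1 :- (T₁ :+ b :^ 1)
                     D₂′ = S₂ :+ u :^ 2 :- (T₂ :+ b :^ 2)
                     D₃′ = S₃ :+ u :^ 3 :- (T₃ :+ b :^ 3)
                 in
                 p :* (:ι 6 :* g :* u :^ 2 :* e) :+ (:- (p :* D₁)) :* (:- (:ι 6 :* g :* u :* e))
                   :+ p :* (D₁ :^ 2 :+ D₂) :* (:ι 3 :* g :* e)
                   :+ (:- (p :* (D₁ :^ 3 :+ :ι 2 :* D₃ :+ :ι 3 :* D₁ :* D₂))) :* g :=
                 (:- (pv :* a :* (pw :* u) :*
                   (D₁′ :^ 3 :+ :ι 2 :* D₃′ :+ :ι 3 :* D₁′ :* D₂′))))
               refl pv pw a u (b n) (S 1) (T 1) (S 2) (T 2) (S 3) (T 3) ⟩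
          - (ratio (suc n) * Dᴱ (suc n)) ∎
      }
      where
      open IsTaylor (taylor n λ j j<n → inv j (ℕ.m<n⇒m<1+n j<n))
      P = JD.∏ n V J.* JD.∏ n W
      P′ = JD.∏ (suc n) V J.* JD.∏ (suc n) W
      pv = ∏ n v
      pw = ∏ n w
      a = v n
      u = w n
      g = a * u
      e = b n - u
      S T : ℕ → Carrier
      S ℓ = ∑ n (λ j → w j ^ ℓ)
      T ℓ = ∑ n (λ j → b j ^ ℓ)
      P*VW : P′ ≋ P J.* jet g (g * e) (- (g * u * e)) (g * u ^ 2 * e)
      P*VW = J.trans (interchange (JD.∏ n V) (V n) (JD.∏ n W) (W n))
        (J.*-congˡ (factor n (inv n ℕ.≤-refl)))
        where open CommutativeSemigroupProperties J.*-commutativeSemigroup using (interchange)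

    module _ (q : Carrier) where

      -- By the Leibniz rule, `ratio n` times this is - 6 times the coefficient of ε³ in L P, where
      -- L = 1 + n y / (1 + x - y + ε) has the higher coefficients - n y q², n y q³ and - n y q⁴.
      -- The signs of these and of the coefficients of P combine to make every term positive.
      bracket : ℕ → Carrier
      bracket n = (1# + ι n * y * q) * Dᴱ n + ι 3 * ι n * y * q ^ 2 * Dᶠ n
        + ι 6 * ι n * y * q ^ 3 * D 1 n + ι 6 * ι n * y * q ^ 4

      δ-falling-harmonic⁗ : ∀ {n m} → n ≡ 2 ℕ.+ m → q * (x - y + ι 1) ≈ 1# →
        (∀ j → j < n → w j * (x + ι (suc j)) ≈ 1#) →
        (∀ j → j < n → b j * v j ≈ 1#) →
        ι 6 * (y * (y - 1#) * δ n (λ k → falling (y - ι 2 + ι k) m * ∑ k (λ j → w j ^ 4))) ≈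
        (- 1#) ^ m * ι (m !) * (ratio n * bracket n)
      δ-falling-harmonic⁗ {n} {m} ≡.refl q-inv w-inv b-inv = begin
        ι 6 * (z * δ n H⁗)
          -- The coefficient of ε³ in the inverse of x + j + 1 + ε is - w⁴; this sign turns 6 into -
          -- 6.
          ≈⟨ solve 3 (λ ι₆ z d → ι₆ :* (z :* d) := (:- ι₆) :* (z :* ((:- con 1ℤ) :* d)))
             refl (ι 6) z (δ n H⁗) ⟩
        - ι 6 * (z * (- 1# * δ n H⁗))
          ≈⟨ *-congˡ lhs ⟨
        - ι 6 * c₃ (Y J.* (Y J.- J.1#) J.* JD.δ n HJ)
          -- The order 1 identity over jets: x becomes x + ε, y stays constant, and `reciprocal q`
          -- inverts 1 + x + ε - y.
          ≈⟨ *-congˡ (≈₃ (JD.δ-falling-harmonic (linear x) Y (reciprocal q) Q-inv W m W-inv)) ⟩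
        - ι 6 * c₃ ((J.- J.1#) JExp.^ m J.* JD.ι (m !)
          J.* ((J.1# J.+ JD.ι n J.* Y J.* reciprocal q) J.* P J.- J.1#))
          ≈⟨ *-congˡ (≈₃ (J.*-cong sign (J.+-congʳ (J.*-congʳ 1+nyq)))) ⟩
        - ι 6 * c₃ (constant (s * ι (m !)) J.* (L J.* P J.- J.1#))
          ≈⟨ *-congˡ (≈₃ (constant-*ˡ (s * ι (m !)) (L J.* P J.- J.1#))) ⟩
        - ι 6 * (s * ι (m !) * (c₀ L * c₃ P + c₁ L * c₂ P + c₂ L * c₁ P + c₃ L * c₀ P - 0#))
          ≈⟨ solve 9 (λ t L₀ L₁ L₂ L₃ P₀ P₁ P₂ P₃ →
               (:- :ι 6) :* (t :* (L₀ :* P₃ :+ L₁ :* P₂ :+ L₂ :* P₁ :+ L₃ :* P₀ :- con 0ℤ)) :=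
               (:- t) :* (L₀ :* (:ι 6 :* P₃) :+ :ι 3 :* L₁ :* (:ι 2 :* P₂)
                 :+ :ι 6 :* L₂ :* P₁ :+ :ι 6 :* L₃ :* P₀))
             refl (s * ι (m !)) (c₀ L) (c₁ L) (c₂ L) (c₃ L) (c₀ P) (c₁ P) (c₂ P) (c₃ P) ⟩
        - (s * ι (m !)) * (c₀ L * (ι 6 * c₃ P) + ι 3 * c₁ L * (ι 2 * c₂ P)
          + ι 6 * c₂ L * c₁ P + ι 6 * c₃ L * c₀ P)
          ≈⟨ *-congˡ (+-cong (+-cong (+-cong (*-congˡ f‴) (*-congˡ f″)) (*-congˡ f′)) (*-congˡ f)) ⟩
        - (s * ι (m !)) * (c₀ L * - (ratio n * Dᴱ n) + ι 3 * c₁ L * (ratio n * Dᶠ n)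
          + ι 6 * c₂ L * - (ratio n * D 1 n) + ι 6 * c₃ L * ratio n)
          ≈⟨ solve 8 (λ t p ny q E F D₁ ι₃ →
               (:- t) :* ((con 1ℤ :+ ny :* q) :* (:- (p :* E))
                 :+ ι₃ :* (ny :* (:- q :^ 2)) :* (p :* F)
                 :+ :ι 6 :* (ny :* q :^ 3) :* (:- (p :* D₁)) :+ :ι 6 :* (ny :* (:- q :^ 4)) :* p) :=
               t :* (p :* ((con 1ℤ :+ ny :* q) :* E :+ ι₃ :* ny :* q :^ 2 :* F
                 :+ :ι 6 :* ny :* q :^ 3 :* D₁ :+ :ι 6 :* ny :* q :^ 4)))
             refl (s * ι (m !)) (ratio n) (ι n * y) q (Dᴱ n) (Dᶠ n) (D 1 n) (ι 3) ⟩
        s * ι (m !) * (ratio n * ((1# + ι n * y * q) * Dᴱ n + ι 3 * (ι n * y) * q ^ 2 * Dᶠ n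
          + ι 6 * (ι n * y) * q ^ 3 * D 1 n + ι 6 * (ι n * y) * q ^ 4))
          ≈⟨ *-congˡ (*-congˡ (+-cong (+-cong (+-congˡ (*-congʳ (*-congʳ (sym (*-assoc _ _ _)))))
               (*-congʳ (*-congʳ (sym (*-assoc _ _ _))))) (*-congʳ (sym (*-assoc _ _ _))))) ⟩
        s * ι (m !) * (ratio n * bracket n) ∎
        where
        s = (- 1#) ^ m
        z = y * (y - 1#)
        Y = constant y
        P = JD.∏ n V J.* JD.∏ n W
        L = jet (1# + ι n * y * q) (ι n * y * - q ^ 2) (ι n * y * q ^ 3) (ι n * y * - q ^ 4)
        open IsTaylor (taylor n b-inv)

        H⁗ : ℕ → Carrier
        H⁗ k = falling (y - ι 2 + ι k) m * ∑ k (λ j → w j ^ 4)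
        HJ : ℕ → Jet
        HJ k = JD.falling (Y J.- JD.ι 2 J.+ JD.ι k) m J.* JD.∑ k W

        Q-inv : reciprocal q J.* (linear x J.- Y J.+ JD.ι 1) ≋ J.1#
        Q-inv = J.trans (J.*-congˡ (linear-V 0)) (reciprocal-inverse q-inv)

        W-inv : ∀ j → j < n → W j J.* (linear x J.+ JD.ι (suc j)) ≋ J.1#
        W-inv j j<n = J.trans (J.*-congˡ (linear-+ x (suc j))) (reciprocal-inverse (w-inv j j<n))

        sign : (J.- J.1#) JExp.^ m J.* JD.ι (m !) ≋ constant (s * ι (m !))
        sign = J.trans (J.*-cong (constant-sign m) (constant-ι (m !))) (constant-* s (ι (m !)))

        1+nyq : J.1# J.+ JD.ι n J.* Y J.* reciprocal q ≋ L
        1+nyq = J.trans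
          (J.+-congˡ (J.trans
            (J.*-congʳ (J.trans (J.*-congʳ (constant-ι n)) (constant-* (ι n) y)))
            (constant-*ˡ (ι n * y) (reciprocal q))))
          (mk≋ refl (+-identityˡ _) (+-identityˡ _) (+-identityˡ _))

        falling-y : ∀ k → JD.falling (Y J.- JD.ι 2 J.+ JD.ι k) m ≋ constant (falling (y - ι 2 + ι k) m)
        falling-y k = J.trans
          (JD.falling-cong m (J.trans
            (J.+-cong (J.trans (J.+-congˡ (J.-‿cong (constant-ι 2))) (constant-minus y (ι 2))) (constant-ι k))
            (constant-+ (y - ι 2) (ι k))))
          (constant-falling (y - ι 2 + ι k) m)

        c₃-HJ : ∀ k → c₃ (HJ k) ≈ - 1# * H⁗ k
        c₃-HJ k = begin
          c₃ (HJ k)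
            ≈⟨ ≈₃ (J.*-congʳ (falling-y k)) ⟩
          c₃ (constant φ J.* JD.∑ k W)
            ≈⟨ ≈₃ (constant-*ˡ φ (JD.∑ k W)) ⟩
          φ * c₃ (JD.∑ k W)
            ≡⟨ cong (φ *_) (c₃-∑ k W) ⟩
          φ * ∑ k (λ j → - w j ^ 4)
            ≈⟨ *-congˡ (∑-neg k (λ j → w j ^ 4)) ⟩
          φ * (- 1# * ∑ k (λ j → w j ^ 4))
            ≈⟨ solve 2 (λ φ h → φ :* ((:- con 1ℤ) :* h) := (:- con 1ℤ) :* (φ :* h))
               refl φ (∑ k (λ j → w j ^ 4)) ⟩
          - 1# * H⁗ k ∎
          where φ = falling (y - ι 2 + ι k) m

        lhs : c₃ (Y J.* (Y J.- J.1#) J.* JD.δ n HJ) ≈ z * (- 1# * δ n H⁗)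
        lhs = begin
          c₃ (Y J.* (Y J.- J.1#) J.* JD.δ n HJ)
            ≈⟨ ≈₃ (J.*-congʳ (J.trans (J.*-congˡ (constant-minus y 1#)) (constant-* y (y - 1#)))) ⟩
          c₃ (constant z J.* JD.δ n HJ)
            ≈⟨ ≈₃ (constant-*ˡ z (JD.δ n HJ)) ⟩
          z * c₃ (JD.δ n HJ)
            ≡⟨ cong (z *_) (c₃-δ n HJ) ⟩
          z * δ n (c₃ ∘ HJ)
            ≈⟨ *-congˡ (trans (δ-cong n λ k _ → c₃-HJ k) (δ-scale n (- 1#) H⁗)) ⟩
          z * (- 1# * δ n H⁗) ∎

-- Translation to a Heyting field: quotients, binomial coefficients and signed binomial sums.

private

  -- Sums and differences use sequences on all of ℕ, while reciprocals are available for finitely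
  -- many indices only; from n on the sequence takes the default value `a`.
  choose : ∀ {a p} {A : Set a} (P : ℕ → A → Set p) → A → ∀ n →
    ((i : Fin n) → ∃ (P (toℕ i))) → Σ[ f ∈ (ℕ → A) ] (∀ j → j < n → P j (f j))
  choose P a zero _ = (λ _ → a) , λ _ ()
  choose {A = A} P a (suc n) p = f′ , f′-P
    where
    rest : Σ[ f ∈ (ℕ → A) ] (∀ j → j < n → P (suc j) (f j))
    rest = choose (P ∘ suc) a n (p ∘ suc)
    f′ : ℕ → A
    f′ zero = proj₁ (p zero)
    f′ (suc j) = proj₁ rest j
    f′-P : ∀ j → j < suc n → P j (f′ j)
    f′-P zero _ = proj₂ (p zero)
    f′-P (suc j) (s≤s j<n) = proj₂ rest j j<n

module HeytingFields {c ℓ₁ ℓ₂} (K : HeytingField c ℓ₁ ℓ₂) (char0 : CharacteristicZero K) where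

  open Expressions K char0

  private
    R : CommutativeRing c ℓ₁
    R = HeytingCommutativeRing.commutativeRing (HeytingField.heytingCommutativeRing K)
    module D = Differences R

  open HeytingField K using (#⇒invertible)
  open CommutativeRing R
    using (refl; sym; trans; setoid; semiring; +-cong; +-congˡ; +-congʳ; *-cong; *-congˡ; *-congʳ;
           -‿cong; +-comm; +-assoc; *-identityʳ; *-assoc; *-commutativeSemigroup)
  open IntegerSolver R
  open Sums semiring using (sum-cong-≋)
  open Exp semiring using (^-congˡ)
  open SetoidReasoning setoid
  open D using (δ; ∑; ∏)

  recip : ∀ {u} → u # 0# → Carrier
  recip u#0 = proj₁ (#⇒invertible u#0)

  recip-inverse : ∀ {u} (u#0 : u # 0#) → recip u#0 * u ≈ 1#
  recip-inverse {u} u#0 = trans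
    (*-congˡ (solve 1 (λ u → u := u :- con 0ℤ) refl u)) (proj₁ (proj₂ (#⇒invertible u#0)))

  /-unique : ∀ {u v w} (v#0 : v # 0#) → w * v ≈ u → u / v [ v#0 ] ≈ w
  /-unique {u} {v} {w} v#0 eq = begin
    u * recip v#0          ≈⟨ *-congʳ eq ⟨
    w * v * recip v#0      ≈⟨ solve 3 (λ w v r → w :* v :* r := w :+ w :* (r :* v :- con 1ℤ))
                              refl w v (recip v#0) ⟩
    _                      ≈⟨ drop w (recip-inverse v#0) ⟩
    w                      ∎

  /-inverse : ∀ {u v w} (v#0 : v # 0#) → w * v ≈ 1# → u / v [ v#0 ] ≈ u * w
  /-inverse {u} v#0 inv = /-unique v#0 (trans (*-assoc _ _ _) (trans (*-congˡ inv) (*-identityʳ u)))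

  ^-inverse : ∀ {u v} ℓ → u * v ≈ 1# → u ^ ℓ * v ^ ℓ ≈ 1#
  ^-inverse zero inv = *-identityʳ 1#
  ^-inverse {u} {v} (suc ℓ) inv =
    trans (interchange u (u ^ ℓ) v (v ^ ℓ)) (trans (*-cong inv (^-inverse ℓ inv)) (*-identityʳ 1#))
    where open CommutativeSemigroupProperties *-commutativeSemigroup using (interchange)

  sum-∑ : ∀ n f → ∑[ i < n ] f (toℕ i) ≈ ∑ n f
  sum-∑ zero f = refl
  sum-∑ (suc n) f = trans (+-congˡ (sum-∑ n (f ∘ suc))) (sym (D.∑-head n f))

  reciprocals : ∀ {n u} → u ∉⟦ ℤ.- + n , -1ℤ ⟧ →
    Σ[ w ∈ (ℕ → Carrier) ] (∀ j → j < n → w j * (u + ι (suc j)) ≈ 1#)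
  reciprocals {n} {u} u∉ = choose (λ j v → v * (u + ι (suc j)) ≈ 1#) 0# n
    (λ i → recip (+k#0 u∉ i) , recip-inverse (+k#0 u∉ i))

  -- An inverse is determined up to `≈`, so a single sequence `w` serves all `H ℓ k` with k ≤ n,
  -- although each of them carries its own invertibility proofs.
  H-∑ : ∀ ℓ {n u} {w : ℕ → Carrier} (u∉ : u ∉⟦ ℤ.- + n , -1ℤ ⟧) →
    (∀ j → j < n → w j * (u + ι (suc j)) ≈ 1#) → H ℓ n u u∉ ≈ ∑ n (λ j → w j ^ ℓ)
  H-∑ ℓ {n} {u} {w} u∉ inv = trans
    (sum-cong-≋ λ i → /-unique (^-#0 ℓ (+k#0 u∉ i))
      (^-inverse {w (toℕ i)} {u + ι (suc (toℕ i))} ℓ (inv (toℕ i) (Fin.toℕ<n i))))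
    (sum-∑ n (λ j → w j ^ ℓ))

  falling≡ : ∀ u k → falling u k ≡ D.falling u k
  falling≡ u zero = ≡.refl
  falling≡ u (suc k) = cong (_* (u - ι k)) (falling≡ u k)

  κ : ℕ → Carrier
  κ k = recip (ι-#0 (k !) {{k ℕ.!≢0}})

  κ-inverse : ∀ k → κ k * ι (k !) ≈ 1#
  κ-inverse k = recip-inverse (ι-#0 (k !) {{k ℕ.!≢0}})

  κ-suc : ∀ k → κ k ≈ κ (suc k) * ι (suc k)
  κ-suc k = begin
    κ k
      ≈⟨ solve 4 (λ a b m f → a := b :* m :+ b :* m :* (a :* f :- con 1ℤ)
           :+ (:- a) :* (b :* (m :* f) :- con 1ℤ)) refl (κ k) (κ (suc k)) (ι (suc k)) (ι (k !)) ⟩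
    _ ≈⟨ drop _ (trans (*-congˡ (sym (D.ι-* (suc k) (k !)))) (κ-inverse (suc k))) ⟩
    _ ≈⟨ drop _ (κ-inverse k) ⟩
    κ (suc k) * ι (suc k) ∎

  binom≡ : ∀ u k → binom u k ≡ D.falling u k * κ k
  binom≡ u k = cong (_* κ k) (falling≡ u k)

  -- After the leading factor n + 1 is pulled out of the falling factorial, it splits as (n - k) +
  -- (k + 1), one part for each binomial.
  pascal : ∀ n k → binom (ι (suc n)) (suc k) ≈ binom (ι n) (suc k) + binom (ι n) k
  pascal n k = begin
    binom (ι (suc n)) (suc k)
      ≡⟨ binom≡ (ι (suc n)) (suc k) ⟩
    D.falling (1# + ι n) (suc k) * κ (suc k)
      ≈⟨ *-congʳ (trans (D.falling-cong (suc k) (+-comm 1# (ι n))) (D.falling-suc (ι n) k)) ⟩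
    (ι n + 1#) * φ * κ (suc k)
      ≈⟨ solve 4 (λ n φ r k → (n :+ con 1ℤ) :* φ :* r :=
           φ :* (n :- k) :* r :+ φ :* (r :* (con 1ℤ :+ k))) refl (ι n) φ (κ (suc k)) (ι k) ⟩
    φ * (ι n - ι k) * κ (suc k) + φ * (κ (suc k) * ι (suc k))
      ≈⟨ +-congˡ (*-congˡ (κ-suc k)) ⟨
    φ * (ι n - ι k) * κ (suc k) + φ * κ k
      ≡⟨ ≡.cong₂ _+_ (binom≡ (ι n) (suc k)) (binom≡ (ι n) k) ⟨
    binom (ι n) (suc k) + binom (ι n) k ∎
    where φ = D.falling (ι n) k

  -- The upper limit N is independent of n because Pascal's rule yields the sums for n with two
  -- different limits. Terms beyond n vanish, which the base case settles through `falling-0`.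
  signed-binomial-sum : ∀ {n N} → n ≤ N → ∀ f →
    ∑ (suc N) (λ k → (- 1#) ^ k * binom (ι n) k * f k) ≈ δ n f
  signed-binomial-sum {zero} {N} _ f = begin
    ∑ (suc N) g                                     ≈⟨ D.∑-head N g ⟩
    1# * binom 0# 0 * f 0 + ∑ N (g ∘ suc)           ≈⟨ +-cong (*-congʳ (*-congˡ binom-0)) (vanish N) ⟩
    1# * 1# * f 0 + 0#                              ≈⟨ solve 1 (λ a → con 1ℤ :* con 1ℤ :* a :+ con 0ℤ := a)
                                                       refl (f 0) ⟩
    f 0                                             ∎
    where
    g : ℕ → Carrier
    g k = (- 1#) ^ k * binom 0# k * f k
    binom-0 : binom 0# 0 ≈ 1#
    binom-0 = /-unique (ι-#0 1) (solve 0 (con 1ℤ :* :ι 1 := con 1ℤ) refl)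
    vanish : ∀ N → ∑ N (g ∘ suc) ≈ 0#
    vanish zero = refl
    vanish (suc N) = begin
      ∑ N (g ∘ suc) + s * binom 0# (suc N) * f (suc N)
        ≡⟨ cong (λ b → ∑ N (g ∘ suc) + s * b * f (suc N)) (binom≡ 0# (suc N)) ⟩
      ∑ N (g ∘ suc) + s * (D.falling 0# (suc N) * κ (suc N)) * f (suc N)
        ≈⟨ +-cong (vanish N) (*-congʳ (*-congˡ (*-congʳ (D.falling-0 N)))) ⟩
      0# + s * (0# * κ (suc N)) * f (suc N)
        ≈⟨ solve 3 (λ s r a → con 0ℤ :+ s :* (con 0ℤ :* r) :* a := con 0ℤ)
           refl s (κ (suc N)) (f (suc N)) ⟩
      0# ∎
      where s = (- 1#) ^ suc N
  signed-binomial-sum {suc n} {suc N} (s≤s n≤N) f = begin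
    ∑ (2 ℕ.+ N) (λ k → b (suc n) k * f k)
      ≈⟨ D.∑-head (suc N) (λ k → b (suc n) k * f k) ⟩
    b (suc n) 0 * f 0 + ∑ (suc N) (λ k → b (suc n) (suc k) * f (suc k))
      ≈⟨ +-congˡ (trans (D.∑-cong (suc N) λ k _ → step k)
           (D.∑-minus (suc N) (λ k → b n (suc k) * f (suc k)) (λ k → b n k * f (suc k)))) ⟩
    b n 0 * f 0 + (∑ (suc N) (λ k → b n (suc k) * f (suc k)) - ∑ (suc N) (λ k → b n k * f (suc k)))
      ≈⟨ +-assoc _ _ _ ⟨
    b n 0 * f 0 + ∑ (suc N) (λ k → b n (suc k) * f (suc k)) - ∑ (suc N) (λ k → b n k * f (suc k))
      ≈⟨ +-congʳ (D.∑-head (suc N) (λ k → b n k * f k)) ⟨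
    ∑ (2 ℕ.+ N) (λ k → b n k * f k) - ∑ (suc N) (λ k → b n k * f (suc k))
      ≈⟨ +-cong (signed-binomial-sum (ℕ.m≤n⇒m≤1+n n≤N) f)
                (-‿cong (signed-binomial-sum n≤N (f ∘ suc))) ⟩
    δ n f - δ n (f ∘ suc)
      ≈⟨ D.δ-suc n f ⟨
    δ (suc n) f ∎
    where
    b : ℕ → ℕ → Carrier
    b n k = (- 1#) ^ k * binom (ι n) k
    step : ∀ k → b (suc n) (suc k) * f (suc k) ≈ b n (suc k) * f (suc k) - b n k * f (suc k)
    step k = begin
      - 1# * s * binom (ι (suc n)) (suc k) * f (suc k)
        ≈⟨ *-congʳ (*-congˡ (pascal n k)) ⟩
      - 1# * s * (binom (ι n) (suc k) + binom (ι n) k) * f (suc k)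
        ≈⟨ solve 4 (λ s p q a → (:- con 1ℤ) :* s :* (p :+ q) :* a :=
             (:- con 1ℤ) :* s :* p :* a :- s :* q :* a)
           refl s (binom (ι n) (suc k)) (binom (ι n) k) (f (suc k)) ⟩
      b n (suc k) * f (suc k) - b n k * f (suc k) ∎
      where s = (- 1#) ^ k

  -- By `falling-exchange` the quotient of the binomials is `falling (y + ι k) n * Y`. The two
  -- leading factors of this falling factorial are y + k and y + k - 1, which the last fraction
  -- cancels.
  coefficient : ∀ {n m} y k {Y} → n ≡ 2 ℕ.+ m → Y * D.falling y n ≈ 1# →
    (b#0 : binom (y - ι n + ι k) k # 0#) (d#0 : (y + ι k - 1#) * (y + ι k) # 0#) →
    binom (y + ι k) k / binom (y - ι n + ι k) k [ b#0 ]
      * ((y - 1#) * y / ((y + ι k - 1#) * (y + ι k)) [ d#0 ]) ≈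
    Y * (y * (y - 1#)) * D.falling (y - ι 2 + ι k) m
  coefficient {n} {m} y k {Y} ≡.refl Y-inv b#0 d#0 = begin
    A * recip b#0 * (C * recip d#0)
      ≈⟨ interchange A (recip b#0) C (recip d#0) ⟩
    A * C * (recip b#0 * recip d#0)
      ≈⟨ *-congʳ A*C ⟩
    E * (B * d) * (recip b#0 * recip d#0)
      ≈⟨ solve 5 (λ E B d r s → E :* (B :* d) :* (r :* s) :=
           E :+ E :* (s :* d) :* (r :* B :- con 1ℤ) :+ E :* (s :* d :- con 1ℤ))
         refl E B d (recip b#0) (recip d#0) ⟩
    _ ≈⟨ drop _ (recip-inverse d#0) ⟩
    _ ≈⟨ drop _ (recip-inverse b#0) ⟩
    E ∎
    where
    open CommutativeSemigroupProperties *-commutativeSemigroup using (interchange)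
    u = y + ι k
    A = binom u k
    B = binom (y - ι n + ι k) k
    C = (y - 1#) * y
    d = (u - 1#) * u
    E = Y * (y * (y - 1#)) * D.falling (y - ι 2 + ι k) m
    φ = D.falling u k
    ψ = D.falling (y - ι n + ι k) k
    A*C : A * C ≈ E * (B * d)
    A*C = begin
      A * C
        ≡⟨ cong (_* C) (binom≡ u k) ⟩
      φ * κ k * C
        ≈⟨ *-congʳ (drop _ Y-inv) ⟨
      (φ * κ k + φ * κ k * (Y * D.falling y n - 1#)) * C
        ≈⟨ solve 5 (λ φ κ y Y f → (φ :* κ :+ φ :* κ :* (Y :* f :- con 1ℤ)) :* ((y :- con 1ℤ) :* y) :=
             Y :* (y :* (y :- con 1ℤ)) :* κ :* (φ :* f)) refl φ (κ k) y Y (D.falling y n) ⟩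
      Y * (y * (y - 1#)) * κ k * (φ * D.falling y n)
        ≈⟨ *-congˡ (D.falling-exchange y n k) ⟩
      Y * (y * (y - 1#)) * κ k * (D.falling u n * ψ)
        ≈⟨ *-congˡ (*-congʳ (trans (D.falling-2+ u m) (*-congˡ (D.falling-cong m
             (solve 3 (λ y k t → y :+ k :- t := y :- t :+ k) refl y (ι k) (ι 2)))))) ⟩
      Y * (y * (y - 1#)) * κ k * (u * (u - 1#) * D.falling (y - ι 2 + ι k) m * ψ)
        ≈⟨ solve 5 (λ c κ u f ψ → c :* κ :* (u :* (u :- con 1ℤ) :* f :* ψ) :=
             c :* f :* (ψ :* κ :* ((u :- con 1ℤ) :* u)))
           refl (Y * (y * (y - 1#))) (κ k) u (D.falling (y - ι 2 + ι k) m) ψ ⟩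
      E * (ψ * κ k * d)
        ≡⟨ cong (λ b → E * (b * d)) (binom≡ (y - ι n + ι k) k) ⟨
      E * (B * d) ∎

  sign-2+ : ∀ {n m} → n ≡ 2 ℕ.+ m → (- 1#) ^ n ≈ (- 1#) ^ m
  sign-2+ {m = m} ≡.refl = solve 1 (λ s → (:- con 1ℤ) :* ((:- con 1ℤ) :* s) := s) refl ((- 1#) ^ m)

  -- The origin of n (n - 1) in the denominator of the theorem: the finite difference produces m !,
  -- whereas the inverse of `binom y n` contains n !.
  factorial-2+ : ∀ {n m} → n ≡ 2 ℕ.+ m → ι (n !) ≈ ι n * (ι n - 1#) * ι (m !)
  factorial-2+ {n} {m} ≡.refl = begin
    ι (n !)                          ≈⟨ trans (D.ι-* n (suc m !)) (*-congˡ (D.ι-* (suc m) (m !))) ⟩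
    ι n * (ι (suc m) * ι (m !))      ≈⟨ solve 3 (λ n k f → n :* (k :* f) := n :* (con 1ℤ :+ k :- con 1ℤ) :* f)
                                        refl (ι n) (ι (suc m)) (ι (m !)) ⟩
    ι n * (ι n - 1#) * ι (m !)       ∎

  -- The identity over a Heyting field of characteristic zero.

  regroup : ∀ {a α β e f g h} → α * β ≈ e * f → h ≈ g → a * α * β * h ≈ a * (e * (f * g))
  regroup {a} {α} {β} {e} {f} {g} {h} eq h≈g = begin
    a * α * β * h          ≈⟨ *-cong (*-assoc a α β) h≈g ⟩
    a * (α * β) * g        ≈⟨ *-congʳ (*-congˡ eq) ⟩
    a * (e * f) * g        ≈⟨ trans (*-assoc a (e * f) g) (*-congˡ (*-assoc e f g)) ⟩
    a * (e * (f * g))      ∎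

  module _
    (n : ℕ) (x y : Carrier)
    (x∉-upTo : (i : Fin (suc n)) → x ∉⟦ ℤ.- + toℕ i , -1ℤ ⟧)
    (b#0 : (i : Fin (suc n)) → binom (y - ι n + ι (toℕ i)) (toℕ i) # 0#)
    (d#0 : (i : Fin (suc n)) → (y + ι (toℕ i) - 1#) * (y + ι (toℕ i)) # 0#)
    (r#0 : ι 6 * ι n * (ι n - 1#) * (1# + x - y) # 0#)
    (c#0 : binom (x + ι n) n * binom y n # 0#)
    (v#0 : 1# + x - y # 0#) (e f g : Carrier)
    where

    Equation : Set ℓ₁
    Equation =
      (∑[ i ≤ n ] (let k = toℕ i in
          (- 1#) ^ k
        * binom (ι n) k
        * (binom (y + ι k) k / binom (y - ι n + ι k) k [ b#0 i ])
        * ((y - 1#) * y / ((y + ι k - 1#) * (y + ι k)) [ d#0 i ])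
        * H 4 k x (x∉-upTo i)))
      ≈
        ((- 1#) ^ n / (ι 6 * ι n * (ι n - 1#) * (1# + x - y)) [ r#0 ])
        * (binom (x - y + ι n) n / (binom (x + ι n) n * binom y n) [ c#0 ])
        * ( (1# + x - y + ι n * y) * e
          + (ι 3 * ι n * y / (1# + x - y) [ v#0 ]) * f
          + g)

    -- Being abstract, Identity is compared argument by argument.  Comparing two copies of Equation
    -- would normalise the invertibility proofs inside them, which is not feasible.
    abstract
      Identity : Set ℓ₁
      Identity = Equation

  abstract
    fromEquation : ∀ {n x y x∉-upTo b#0 d#0 r#0 c#0 v#0 e f g} →
      Equation n x y x∉-upTo b#0 d#0 r#0 c#0 v#0 e f g →
      Identity n x y x∉-upTo b#0 d#0 r#0 c#0 v#0 e f g
    fromEquation eq = eq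

  -- The invertibility proofs are variables, and Δ, e, f, g are given only up to `≈`, so the large
  -- proof terms of `Setup` never have to be inspected inside this argument.
  harmonic-identity : ∀ {n} → 2 ≤ n → (x y : Carrier)
    (x∉ : x ∉⟦ ℤ.- + n , -1ℤ ⟧) (x-y∉ : x - y ∉⟦ ℤ.- + n , -1ℤ ⟧)
    {x∉-upTo : (i : Fin (suc n)) → x ∉⟦ ℤ.- + toℕ i , -1ℤ ⟧}
    {b#0 : (i : Fin (suc n)) → binom (y - ι n + ι (toℕ i)) (toℕ i) # 0#}
    {d#0 : (i : Fin (suc n)) → (y + ι (toℕ i) - 1#) * (y + ι (toℕ i)) # 0#}
    {r#0 : ι 6 * ι n * (ι n - 1#) * (1# + x - y) # 0#}
    {c#0 : binom (x + ι n) n * binom y n # 0#}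
    {v#0 : 1# + x - y # 0#} {q : Carrier} → q * (1# + x - y) ≈ 1# →
    {Δ : ℕ → Carrier} → (∀ ℓ → Δ ℓ ≈ H ℓ n x x∉ - H ℓ n (x - y) x-y∉) →
    {e f g : Carrier} →
    e ≈ Δ 1 ^ 3 + ι 2 * Δ 3 + ι 3 * Δ 1 * Δ 2 →
    f ≈ Δ 1 ^ 2 + Δ 2 →
    g ≈ ι 6 * ι n * y * q ^ 2 * Δ 1 + ι 6 * ι n * y * q ^ 3 →
    Identity n x y x∉-upTo b#0 d#0 r#0 c#0 v#0 e f g
  harmonic-identity {n} 2≤n x y x∉ x-y∉ {x∉-upTo} {b#0} {d#0} {r#0} {c#0} {v#0}
    {q} qv {Δ} Δ≈H {e} {f} {g} e≈ f≈ g≈ = fromEquation (begin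
    _ ≈⟨ sum-cong-≋ summand ⟩
    ∑[ i ≤ n ] t (toℕ i)
      ≈⟨ sum-∑ (suc n) t ⟩
    ∑ (suc n) t
      ≈⟨ signed-binomial-sum {n} ℕ.≤-refl (λ k → Y * (y * (y - 1#)) * h k) ⟩
    δ n (λ k → Y * (y * (y - 1#)) * h k)
      ≈⟨ D.δ-scale n (Y * (y * (y - 1#))) h ⟩
    Y * (y * (y - 1#)) * δ n h
      -- The factor r (6 ν v) = 1 is inserted: its 6 is the one demanded by the evaluation of the
      -- difference, and `r` is the reciprocal that the right side contains.
      ≈⟨ drop _ r-inv ⟨
    Y * (y * (y - 1#)) * δ n h + Y * (y * (y - 1#)) * δ n h * (r * (ι 6 * ν * v) - 1#)
      ≈⟨ solve 7 (λ Y z d r ι₆ n′ v → Y :* z :* d :+ Y :* z :* d :* (r :* (ι₆ :* n′ :* v) :- con 1ℤ) :=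
           r :* n′ :* v :* Y :* (ι₆ :* (z :* d)))
         refl Y (y * (y - 1#)) (δ n h) r (ι 6) ν v ⟩
    r * ν * v * Y * (ι 6 * (y * (y - 1#) * δ n h))
      ≈⟨ *-congˡ (T.δ-falling-harmonic⁗ x y w b q n≡2+m q-inv w-inv b-inv) ⟩
    r * ν * v * Y * (s * ι (m !) * (p * B))
      ≈⟨ solve 8 (λ r ν v Y s f p B →
           r :* ν :* v :* Y :* (s :* f :* (p :* B)) :=
           s :* r :* (p :* (ν :* f :* Y)) :* (v :* B))
         refl r ν v Y s (ι (m !)) p B ⟩
    s * r * (p * (ν * ι (m !) * Y)) * (v * B)
      ≈⟨ *-cong (*-cong (*-congʳ (sign-2+ n≡2+m)) (*-congˡ (*-congʳ (factorial-2+ n≡2+m)))) bracket ⟨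
    (- 1#) ^ n * r * (p * (ι (n !) * Y)) * _
      ≈⟨ *-congʳ (*-congˡ ratio) ⟨
    _ ∎)
    where
    module T = ThirdCoefficient R

    w = proj₁ (reciprocals x∉)
    w-inv = proj₂ (reciprocals x∉)
    b = proj₁ (reciprocals x-y∉)
    b-inv = proj₂ (reciprocals x-y∉)
    r = recip r#0
    m = n ℕ.∸ 2
    n≡2+m = ≡.sym (ℕ.m+[n∸m]≡n 2≤n)
    v = 1# + x - y
    ν = ι n * (ι n - 1#)
    s = (- 1#) ^ m
    -- The inverse of `falling y n`, obtained by multiplying the reciprocal of the product of the
    -- two binomials back by `binom (x + ι n) n` and dividing by n !.
    Y = recip c#0 * binom (x + ι n) n * κ n
    p = T.ratio x y w b n
    h : ℕ → Carrier
    h k = D.falling (y - ι 2 + ι k) m * ∑ k (λ j → w j ^ 4)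
    t : ℕ → Carrier
    t k = (- 1#) ^ k * binom (ι n) k * (Y * (y * (y - 1#)) * h k)

    q-inv : q * (x - y + ι 1) ≈ 1#
    q-inv = trans (*-congˡ (solve 2 (λ x y → x :- y :+ :ι 1 := con 1ℤ :+ x :- y) refl x y)) qv

    B = T.bracket x y w b q n

    r-inv : r * (ι 6 * ν * v) ≈ 1#
    r-inv = trans (*-congˡ (*-congʳ (sym (*-assoc _ _ _)))) (recip-inverse r#0)

    Y-inv : Y * D.falling y n ≈ 1#
    Y-inv = begin
      recip c#0 * binom (x + ι n) n * κ n * D.falling y n
        ≈⟨ solve 4 (λ r a κ f → r :* a :* κ :* f := r :* (a :* (f :* κ)))
           refl (recip c#0) (binom (x + ι n) n) (κ n) (D.falling y n) ⟩
      recip c#0 * (binom (x + ι n) n * (D.falling y n * κ n))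
        ≡⟨ cong (λ b → recip c#0 * (binom (x + ι n) n * b)) (binom≡ y n) ⟨
      recip c#0 * (binom (x + ι n) n * binom y n)
        ≈⟨ recip-inverse c#0 ⟩
      1# ∎

    harmonic : ∀ ℓ i → H ℓ (toℕ i) x (x∉-upTo i) ≈ ∑ (toℕ i) (λ j → w j ^ ℓ)
    harmonic ℓ i = H-∑ ℓ (x∉-upTo i) λ j j<k → w-inv j (ℕ.<-≤-trans j<k (Fin.toℕ≤pred[n] i))

    summand : ∀ i → let k = toℕ i in
        (- 1#) ^ k
      * binom (ι n) k
      * (binom (y + ι k) k / binom (y - ι n + ι k) k [ b#0 i ])
      * ((y - 1#) * y / ((y + ι k - 1#) * (y + ι k)) [ d#0 i ])
      * H 4 k x (x∉-upTo i) ≈ t k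
    summand i = regroup
      (coefficient y (toℕ i) n≡2+m Y-inv (b#0 i) (d#0 i))
      (harmonic 4 i)

    -- The factorials of the binomials in x - y + n and x + n cancel and leave P; `ι (n !) * Y` is
    -- the inverse of `binom y n`.
    ratio : binom (x - y + ι n) n / (binom (x + ι n) n * binom y n) [ c#0 ]
      ≈ p * (ι (n !) * Y)
    ratio = /-unique c#0 (begin
      pv * pw * (ι (n !) * Y) * (binom (x + ι n) n * binom y n)
        ≡⟨ cong (pv * pw * (ι (n !) * Y) *_) (≡.cong₂ _*_ (binom≡ (x + ι n) n) (binom≡ y n)) ⟩
      pv * pw * (ι (n !) * Y) * (φ * κ n * (D.falling y n * κ n))
        ≈⟨ *-congˡ (*-congʳ (*-congʳ (D.falling-+n x n))) ⟩
      pv * pw * (ι (n !) * Y) * (px * κ n * (D.falling y n * κ n))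
        ≈⟨ solve 7 (λ v w f Y x κ φ →
             v :* w :* (f :* Y) :* (x :* κ :* (φ :* κ)) :=
             v :* κ :+ v :* κ :* (w :* x :- con 1ℤ) :+ v :* κ :* (w :* x) :* (κ :* f :- con 1ℤ)
               :+ v :* κ :* (w :* x) :* (κ :* f) :* (Y :* φ :- con 1ℤ))
           refl pv pw (ι (n !)) Y px (κ n) (D.falling y n) ⟩
      _ ≈⟨ drop _ Y-inv ⟩
      _ ≈⟨ drop _ (κ-inverse n) ⟩
      _ ≈⟨ drop _ (D.∏-inverse n w-inv) ⟩
      pv * κ n
        ≈⟨ *-congʳ (D.falling-+n (x - y) n) ⟨
      D.falling (x - y + ι n) n * κ n
        ≡⟨ binom≡ (x - y + ι n) n ⟨
      binom (x - y + ι n) n ∎)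
      where
      pv = ∏ n (λ j → x - y + ι (suc j))
      pw = ∏ n w
      px = ∏ n (λ j → x + ι (suc j))
      φ = D.falling (x + ι n) n

    Δ≈ : ∀ ℓ → Δ ℓ ≈ T.D x y w b ℓ n
    Δ≈ ℓ = trans (Δ≈H ℓ) (+-cong (H-∑ ℓ x∉ w-inv) (-‿cong (H-∑ ℓ x-y∉ b-inv)))

    e′ = T.Dᴱ x y w b n
    f′ = T.Dᶠ x y w b n
    d = T.D x y w b 1 n

    e≈e′ : e ≈ e′
    e≈e′ = trans e≈
      (+-cong (+-cong (^-congˡ 3 (Δ≈ 1)) (*-congˡ (Δ≈ 3))) (*-cong (*-congˡ (Δ≈ 1)) (Δ≈ 2)))

    f≈f′ : f ≈ f′
    f≈f′ = trans f≈ (+-cong (^-congˡ 2 (Δ≈ 1)) (Δ≈ 2))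

    g≈g′ : g ≈ ι 6 * ι n * y * q ^ 2 * d + ι 6 * ι n * y * q ^ 3
    g≈g′ = trans g≈ (+-congʳ (*-congˡ (Δ≈ 1)))

    -- The prefactor of the theorem contains 1 / v, so its braces are v times the Leibniz sum `B`;
    -- by q v = 1 every power of q drops by one.
    bracket : (v + ι n * y) * e + (ι 3 * ι n * y / v [ v#0 ]) * f + g ≈ v * B
    bracket = begin
      _ ≈⟨ +-cong (+-cong (*-congˡ e≈e′) (*-cong (/-inverse v#0 qv) f≈f′)) g≈g′ ⟩
      (v + ι n * y) * e′ + ι 3 * ι n * y * q * f′
        + (ι 6 * ι n * y * q ^ 2 * d + ι 6 * ι n * y * q ^ 3)
        ≈⟨ solve 9 (λ v n y e f d q ι₃ ι₆ →
             (v :+ n :* y) :* e :+ ι₃ :* n :* y :* q :* f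
               :+ (ι₆ :* n :* y :* q :^ 2 :* d :+ ι₆ :* n :* y :* q :^ 3) :=
             v :* ((con 1ℤ :+ n :* y :* q) :* e :+ ι₃ :* n :* y :* q :^ 2 :* f
               :+ ι₆ :* n :* y :* q :^ 3 :* d :+ ι₆ :* n :* y :* q :^ 4)
             :+ (:- (n :* y :* e :+ ι₃ :* n :* y :* q :* f :+ ι₆ :* n :* y :* q :^ 2 :* d
                 :+ ι₆ :* n :* y :* q :^ 3)) :* (q :* v :- con 1ℤ))
           refl v (ι n) y e′ f′ d q (ι 3) (ι 6) ⟩
      _ ≈⟨ drop _ qv ⟩
      v * B ∎

  -- The identity with the denominators of `Setup`.

  module _
    (n : ℕ) (2≤n : 2 ≤ n) (x y : Carrier)
    (x∉ : x ∉⟦ ℤ.- + n , -1ℤ ⟧)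
    (x-y∉ : x - y ∉⟦ ℤ.- + n , -1ℤ ⟧)
    (y∉ : y ∉⟦ ℤ.- + n , + n ℤ.- 1ℤ ⟧)
    where

    open Setup n 2≤n x y x∉ x-y∉ y∉

    private

      q : Carrier
      q = recip 1+x-y#0

      qv : q * (1# + x - y) ≈ 1#
      qv = recip-inverse 1+x-y#0

      G≈ : G ≈ ι 6 * ι n * y * q ^ 2 * Δ 1 + ι 6 * ι n * y * q ^ 3
      G≈ = +-cong (*-congʳ (/-inverse _ (^-inverse 2 qv))) (/-inverse _ (^-inverse 3 qv))

      Δ≈H : ∀ ℓ → Δ ℓ ≈ H ℓ n x x∉ - H ℓ n (x - y) x-y∉
      Δ≈H ℓ = refl

      E≈ : E ≈ Δ 1 ^ 3 + ι 2 * Δ 3 + ι 3 * Δ 1 * Δ 2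
      E≈ = refl

      F≈ : F ≈ Δ 1 ^ 2 + Δ 2
      F≈ = refl

      identity : Identity n x y x∉-upTo binom[y-n+k]#0 [y+k-1][y+k]#0 6n[n-1][1+x-y]#0
        binom[x+n]binom[y]#0 1+x-y#0 E F G
      identity = harmonic-identity 2≤n x y x∉ x-y∉ qv Δ≈H E≈ F≈ G≈

    -- Only within an `abstract` block does `Identity` unfold to the equation it stands for.
    abstract

      theorem20 :
        (∑[ i ≤ n ] (let k = toℕ i in
            (- 1#) ^ k
          * binom (ι n) k
          * (binom (y + ι k) k / binom (y - ι n + ι k) k [ binom[y-n+k]#0 i ])
          * ((y - 1#) * y / ((y + ι k - 1#) * (y + ι k)) [ [y+k-1][y+k]#0 i ])
          * H 4 k x (x∉-upTo i)))
        ≈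
          ((- 1#) ^ n / (ι 6 * ι n * (ι n - 1#) * (1# + x - y)) [ 6n[n-1][1+x-y]#0 ])
          * (binom (x - y + ι n) n / (binom (x + ι n) n * binom y n) [ binom[x+n]binom[y]#0 ])
          * ( (1# + x - y + ι n * y) * E
            + (ι 3 * ι n * y / (1# + x - y) [ 1+x-y#0 ]) * F
            + G)
      theorem20 = identity

-- By module application, since checking the proof against a type written out over ℂ would unfold
-- complex arithmetic.
open HeytingFields ℂ-heytingField ℂ-characteristicZero public using (theorem20)
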